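{- Let $q=p^h$ with $p$ prime, $h\geq 1$, and let $c$ be a codeword of minimum weight of $C(PG(2,q))^\perp$. If $p=7$, then $wt(c)\geq (12q+6)/7$. If $p>7$, then $wt(c)\geq (12q+18)/7$. No divisibility assumption on $wt(c)$ is required.
   Context: $C(PG(2,q))$ is the $\mathbb{F}_p$-span of the incidence vectors of the lines of $PG(2,q)$, with coordinates indexed by points. $C^\perp$ is its dual with respect to the standard scalar product over $\mathbb{F}_p$. The weight is the number of nonzero coordinates. -}

module Defs where

open import Algebra.Apartness.Bundles using (HeytingField; HeytingCommutativeRing)
open import Algebra.Bundles using (CommutativeRing)
import Algebra.Apartness.Properties.HeytingCommutativeRing as HCR
import Algebra.Properties.Semiring.Sum as Sum
open import Data.Bool.Base using (if_then_else_)
open import Data.Fin.Base using (Fin)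
import Data.Fin.Properties as Fin
open import Data.List.Base using (allFin; filter; length)
open import Data.Nat.Base using (ℕ; _≤_)
open import Data.Product.Base using (∃-syntax; Σ-syntax; _×_; _,_)
open import Data.Vec.Functional using (Vector)
import Data.Vec.Functional.Relation.Binary.Equality.Setoid as VecEquality
open import Function.Bundles using (Inverse)
open import Function.Properties.Inverse using (Inverse⇒Injection)
open import Level using (Level; _⊔_) renaming (suc to lsuc)
open import Relation.Binary.Bundles using (Setoid)
open import Relation.Binary.Definitions using (Decidable)
import Relation.Binary.PropositionalEquality as ≡
open import Relation.Nullary.Decidable using (does; ¬?; via-injection)
open import Relation.Nullary.Negation using (¬_)
open import Relation.Unary using (Pred; _∈_)

private
  variable
    a c ℓ ℓ₁ ℓ₂ : Level

Enumeration : Setoid c ℓ → ℕ → Set (c ⊔ ℓ)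
Enumeration S n = Inverse S (≡.setoid (Fin n))

-- For a finite carrier, _≈_ is decidable and x # y is equivalent to
-- ¬ (x ≈ y), so a Heyting field of finite order is exactly a finite field.
record FiniteField c ℓ₁ ℓ₂ (q : ℕ) : Set (lsuc (c ⊔ ℓ₁ ⊔ ℓ₂)) where
  field
    heytingField : HeytingField c ℓ₁ ℓ₂

  open HeytingField heytingField public
  open CommutativeRing (HeytingCommutativeRing.commutativeRing heytingCommutativeRing) public
    using (semiring)

  field
    elements : Enumeration setoid q

  infix 4 _≟_

  _≟_ : Decidable _≈_
  _≟_ = via-injection (Inverse⇒Injection elements) Fin._≟_

  open Sum semiring public using (sum)
  open VecEquality setoid public using (_≋_)

  0ᵛ : ∀ {n} → Vector Carrier n
  0ᵛ _ = 0#

  infix 7 _∙_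

  _∙_ : ∀ {n} → Vector Carrier n → Vector Carrier n → Carrier
  x ∙ y = sum λ i → x i * y i

  Span : ∀ {n} {I : Set a} → (I → Vector Carrier n) → Pred (Vector Carrier n) (a ⊔ c ⊔ ℓ₁)
  Span {I = I} v x =
    ∃[ m ] Σ[ α ∈ Vector Carrier m ] Σ[ i ∈ Vector I m ]
      x ≋ (λ k → sum λ j → α j * v (i j) k)

  Dual : ∀ {n} → Pred (Vector Carrier n) ℓ → Pred (Vector Carrier n) (c ⊔ ℓ₁ ⊔ ℓ)
  Dual C x = ∀ y → y ∈ C → x ∙ y ≈ 0#

  wt : ∀ {n} → Vector Carrier n → ℕ
  wt x = length (filter (λ i → ¬? (x i ≟ 0#)) (allFin _))

  -- As usual, the minimum is over the nonzero codewords.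
  IsMinimumWeightCodeword : ∀ {n} → Pred (Vector Carrier n) ℓ → Pred (Vector Carrier n) (c ⊔ ℓ₁ ⊔ ℓ)
  IsMinimumWeightCodeword C x =
    x ∈ C × ¬ (x ≋ 0ᵛ) × (∀ y → y ∈ C → ¬ (y ≋ 0ᵛ) → wt x ≤ wt y)

-- PG(2,q) in homogeneous coordinates: a point is given by a nonzero vector
-- u of F³, a line by the nonzero coefficient vector l of its equation
-- l ∙ u ≈ 0#, both up to a nonzero scalar.
module PG2 {q : ℕ} (F : FiniteField c ℓ₁ ℓ₂ q) where
  open FiniteField F
  open HCR heytingCommutativeRing using (1#0; x-0≈x; invertibleʳ⇒#; x#0y#0→xy#0)

  Homogeneous : Set (c ⊔ ℓ₁)
  Homogeneous = Σ[ u ∈ Vector Carrier 3 ] ¬ (u ≋ 0ᵛ)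

  Point Line : Set (c ⊔ ℓ₁)
  Point = Homogeneous
  Line  = Homogeneous

  infix 4 _∼_

  _∼_ : Point → Point → Set (c ⊔ ℓ₁ ⊔ ℓ₂)
  (u , _) ∼ (v , _) = ∃[ α ] α # 0# × (∀ i → α * u i ≈ v i)

  ∼-refl : ∀ {P} → P ∼ P
  ∼-refl = 1# , 1#0 , λ _ → *-identityˡ _

  ∼-sym : ∀ {P Q} → P ∼ Q → Q ∼ P
  ∼-sym (α , α#0 , αu≈v) with #⇒invertible α#0
  ... | β , β[α-0]≈1 , _ =
    β , invertibleʳ⇒# (α , trans (*-congʳ (x-0≈x β)) βα≈1) ,
    λ i → trans (*-congˡ (sym (αu≈v i)))
         (trans (sym (*-assoc _ _ _))
         (trans (*-congʳ βα≈1) (*-identityˡ _)))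
    where
    βα≈1 : β * α ≈ 1#
    βα≈1 = trans (*-congˡ (sym (x-0≈x α))) β[α-0]≈1

  ∼-trans : ∀ {P Q R} → P ∼ Q → Q ∼ R → P ∼ R
  ∼-trans (α , α#0 , αu≈v) (β , β#0 , βv≈w) =
    β * α , x#0y#0→xy#0 β#0 α#0 ,
    λ i → trans (*-assoc _ _ _) (trans (*-congˡ (αu≈v i)) (βv≈w i))

  points : Setoid (c ⊔ ℓ₁) (c ⊔ ℓ₁ ⊔ ℓ₂)
  points = record
    { Carrier       = Point
    ; _≈_           = _∼_
    ; isEquivalence = record
      { refl  = λ {P} → ∼-refl {P}
      ; sym   = λ {P Q} → ∼-sym {P} {Q}
      ; trans = λ {P Q R} → ∼-trans {P} {Q} {R}
      }
    }

  infix 4 _on_ _on?_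

  _on_ : Point → Line → Set ℓ₁
  (u , _) on (l , _) = l ∙ u ≈ 0#

  _on?_ : Decidable _on_
  (u , _) on? (l , _) = l ∙ u ≟ 0#

-- An enumeration of the points fixes the order of the coordinates.
module LineCode
  {c′ ℓ₁′ ℓ₂′ : Level} {q p n : ℕ}
  (F : FiniteField c ℓ₁ ℓ₂ q) (K : FiniteField c′ ℓ₁′ ℓ₂′ p)
  (enum : Enumeration (PG2.points F) n)
  where
  open PG2 F
  open FiniteField K

  incidenceVector : Line → Vector Carrier n
  incidenceVector L i = if does (Inverse.from enum i on? L) then 1# else 0#

  C : Pred (Vector Carrier n) (c ⊔ ℓ₁ ⊔ c′ ⊔ ℓ₁′)
  C = Span incidenceVector

  C⊥ : Pred (Vector Carrier n) (c ⊔ ℓ₁ ⊔ c′ ⊔ ℓ₁′)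
  C⊥ = Dual C

{-# OPTIONS --safe #-}
module Submission where

-- Let s be the weight of c. A line meets the support of c in points whose
-- values add up to 0, never in exactly one point. Counting on the q + 1 lines
-- through a point of value α gives s + N(-α) ≥ 2q + 3, where N(v) is the number
-- of points of value v; so -α occurs too unless s ≥ 2q + 3.
--   * Three pairs ±a, ±b, ±d of values: adding six such bounds, 7s ≥ 12q + 18.
--   * Two pairs: either there are no 3-secants, and s + 2N(-α) ≥ 3q + 4, or the
--     values are ±e, ±2e, the 3-secants are of type ±(e, e, -2e), and weighted
--     counts give 17s ≥ 30q + 40.
--   * One pair ±a: a line carrying no -a has 0 modulo p points of value a,
--     whence p s ≥ 2 + 2(p - 1)(q + 1).
open import Algebra.Apartness.Bundles using (HeytingCommutativeRing)
import Algebra.Apartness.Properties.HeytingCommutativeRing as HCR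
open import Algebra.Bundles using (CommutativeRing)
import Algebra.Properties.CommutativeSemigroup as CommutativeSemigroup
import Algebra.Properties.Ring as RingProperties
import Algebra.Properties.Semiring.Mult as Mult
import Algebra.Properties.Semiring.Sum as Sum
open import Data.Bool.Base using (Bool; true; false; if_then_else_)
open import Data.Fin.Base using (Fin; zero; suc; punchIn; punchOut)
open import Data.Fin.Patterns using (0F; 1F)
import Data.Fin.Permutation as Permutation
import Data.Fin.Properties as Fin
open import Data.Integer.Base using (+_)
import Data.Integer.Base as ℤ
import Data.Integer.Properties as ℤ
open import Data.List.Base using (List; []; _∷_; filter; length; tabulate)
open import Data.List.Relation.Unary.All as All using (All; []; _∷_)
open import Data.List.Relation.Unary.AllPairs using (AllPairs; []; _∷_)
open import Data.Nat.Base as ℕ using (ℕ; zero; suc; NonZero)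
import Data.Nat.Coprimality as Coprime
import Data.Nat.GCD as GCD
open import Data.Nat.Primality using (Prime; prime?; prime⇒nonZero)
import Data.Nat.Properties as ℕ
open import Data.Nat.Tactic.RingSolver using (solve-∀)
open import Data.Product.Base using (∃-syntax; _×_; _,_; proj₁; proj₂)
open import Data.Rational.Unnormalised.Base using (_/_; *≤*) renaming (_≤_ to _≤ᵘ_)
open import Data.Sum.Base using (_⊎_; inj₁; inj₂; map₂; swap)
open import Data.Vec.Functional as Vec using (Vector)
open import Defs
open import Function.Base using (_∘_; id)
open import Function.Bundles using (Inverse)
open import Level using (Level; _⊔_)
open import Relation.Binary.PropositionalEquality as ≡ using (_≡_; _≢_)
import Relation.Binary.Reasoning.Setoid as ≈-Reasoning
open import Relation.Nullary.Decidable
  using (Dec; yes; no; does; ¬?; dec-true; dec-false; decidable-stable; from-no; _⊎-dec_; _×-dec_)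
open import Relation.Nullary.Negation using (¬_; contradiction)
open import Relation.Unary using (Pred; Decidable)

private
  variable
    a a′ ℓ ℓ₁ ℓ₂ ℓ₁′ ℓ₂′ : Level
    m n p q : ℕ

-- Every estimate is one double count. A weight on the field values, zero at 0, is summed over the
-- `q + 1` lines through a support point of value α. No other point lies on two of these lines, so
-- if each line carries weight at least k away from the point, the total weight is at least the
-- point's own weight plus (q + 1)k. Only the weight changes from case to case. Counting -α twice
-- makes a 2-secant, whose other value must be -α, as heavy as a 3-secant: k = 2 and s + N(-α) ≥ 1 +
-- 2(q + 1).
--
-- With three pairs, the six terms N add up to at most s, which is the origin of 7 = 6 + 1. With two
-- pairs only four such bounds exist; the loss is made up by heavier weights, tuned so that lines
-- with two, three or more support points all reach the same k. The single pair is the only case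
-- whose bound depends on p. At p = 7 it reads 7s ≥ 12q + 14, which lies between 12q + 6 and 12q +
-- 18; this separates p = 7 from p > 7.

module Sumℕ = Sum ℕ.+-*-semiring
open Sumℕ using () renaming (sum to sumℕ)

-- Inverses and linear forms over a finite field

module FiniteFieldProperties (F : FiniteField a ℓ₁ ℓ₂ q) where
  open FiniteField F hiding (zero)
  open HCR heytingCommutativeRing using (invertibleˡ⇒#; x-0≈x)
  open Sum semiring using (sum-cong-≋; ∑-distrib-+; *-distribˡ-sum; sum-replicate-zero)
  open ≈-Reasoning setoid

  -- A Heyting field inverts elements apart from 0, whereas here only an inequality is given.
  -- Finiteness bridges the gap: an inverse is sought by exhaustion, and if there is none, `x` is
  -- not apart from 0 and tightness forces `x ≈ 0#`.
  ≉0⇒inverse : ∀ {x} → ¬ x ≈ 0# → ∃[ y ] y * x ≈ 1#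
  ≉0⇒inverse {x} x≉0 with Fin.any? (λ i → Inverse.from elements i * x ≟ 1#)
  ... | yes (i , yx≈1) = Inverse.from elements i , yx≈1
  ... | no ∄y = contradiction (proj₁ (tight x 0#) ¬x#0) x≉0
    where
    ¬x#0 : ¬ x # 0#
    ¬x#0 x#0 with #⇒invertible x#0
    ... | y , y[x-0]≈1 , _ = ∄y (Inverse.to elements y , (begin
      Inverse.from elements (Inverse.to elements y) * x
        ≈⟨ *-cong (Inverse.strictlyInverseʳ elements y) (sym (x-0≈x x)) ⟩
      y * (x - 0#)  ≈⟨ y[x-0]≈1 ⟩
      1#            ∎))

  ≉0⇒# : ∀ {x} → ¬ x ≈ 0# → x # 0#
  ≉0⇒# {x} x≉0 with ≉0⇒inverse x≉0
  ... | y , yx≈1 = invertibleˡ⇒# (y , trans (*-congˡ (x-0≈x x)) yx≈1)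

  x≉0∧xy≈0⇒y≈0 : ∀ {x y} → ¬ x ≈ 0# → x * y ≈ 0# → y ≈ 0#
  x≉0∧xy≈0⇒y≈0 {x} {y} x≉0 xy≈0 with ≉0⇒inverse x≉0
  ... | z , zx≈1 = begin
    y            ≈⟨ *-identityˡ y ⟨
    1# * y       ≈⟨ *-congʳ zx≈1 ⟨
    (z * x) * y  ≈⟨ *-assoc z x y ⟩
    z * (x * y)  ≈⟨ *-congˡ xy≈0 ⟩
    z * 0#       ≈⟨ zeroʳ z ⟩
    0#           ∎

  ≋̸0⇒∃≉0 : ∀ {n} {u : Vector Carrier n} → ¬ (u ≋ 0ᵛ) → ∃[ i ] ¬ u i ≈ 0#
  ≋̸0⇒∃≉0 {u = u} u≋̸0 with Fin.any? (λ i → ¬? (u i ≟ 0#))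
  ... | yes p = p
  ... | no ∄i = contradiction (λ i → decidable-stable (u i ≟ 0#) (λ u≉0 → ∄i (i , u≉0))) u≋̸0

  δ : ∀ {n} → Fin n → Vector Carrier n
  δ zero    = 1# Vec.∷ 0ᵛ
  δ (suc i) = 0# Vec.∷ δ i

  δᵢᵢ≈1 : ∀ {n} (i : Fin n) → δ i i ≈ 1#
  δᵢᵢ≈1 zero    = refl
  δᵢᵢ≈1 (suc i) = δᵢᵢ≈1 i

  δᵢⱼ≈0 : ∀ {n} {i j : Fin n} → i ≢ j → δ i j ≈ 0#
  δᵢⱼ≈0 {i = zero}  {zero}  i≢j = contradiction ≡.refl i≢j
  δᵢⱼ≈0 {i = zero}  {suc j} i≢j = refl
  δᵢⱼ≈0 {i = suc i} {zero}  i≢j = refl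
  δᵢⱼ≈0 {i = suc i} {suc j} i≢j = δᵢⱼ≈0 (i≢j ∘ ≡.cong suc)

  δᵢ∙v≈vᵢ : ∀ {n} (i : Fin n) v → δ i ∙ v ≈ v i
  δᵢ∙v≈vᵢ {suc n} zero v = begin
    1# * v zero + 0ᵛ ∙ (v ∘ suc)
      ≈⟨ +-cong (*-identityˡ _) (trans (sum-cong-≋ (zeroˡ ∘ v ∘ suc)) (sum-replicate-zero n)) ⟩
    v zero + 0#                   ≈⟨ +-identityʳ _ ⟩
    v zero                        ∎
  δᵢ∙v≈vᵢ (suc i) v = begin
    0# * v zero + δ i ∙ (v ∘ suc)  ≈⟨ +-cong (zeroˡ _) (δᵢ∙v≈vᵢ i (v ∘ suc)) ⟩
    0# + v (suc i)                 ≈⟨ +-identityˡ _ ⟩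
    v (suc i)                      ∎

  combination : ∀ {n} → Carrier → Vector Carrier n → Carrier → Vector Carrier n → Vector Carrier n
  combination α x β y k = α * x k + β * y k

  combination-∙ : ∀ {n} α (x : Vector Carrier n) β y v →
                  combination α x β y ∙ v ≈ α * (x ∙ v) + β * (y ∙ v)
  combination-∙ {n} α x β y v = begin
    sum (λ k → (α * x k + β * y k) * v k)
      ≈⟨ sum-cong-≋ {n} (λ k → trans (distribʳ _ _ _) (+-cong (*-assoc _ _ _) (*-assoc _ _ _))) ⟩
    sum (λ k → α * (x k * v k) + β * (y k * v k))
      ≈⟨ ∑-distrib-+ {n} (λ k → α * (x k * v k)) (λ k → β * (y k * v k)) ⟩
    sum (λ k → α * (x k * v k)) + sum (λ k → β * (y k * v k))
      ≈⟨ +-cong (*-distribˡ-sum α (λ k → x k * v k)) (*-distribˡ-sum β (λ k → y k * v k)) ⟨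
    α * (x ∙ v) + β * (y ∙ v)  ∎

-- The `q + 1` lines through a point

module Pencil (F : FiniteField a ℓ₁ ℓ₂ q) where
  open FiniteField F hiding (zero)
  open PG2 F
  open FiniteFieldProperties F
  open CommutativeRing (HeytingCommutativeRing.commutativeRing heytingCommutativeRing)
    using (ring)
  open RingProperties ring using (x∙y⁻¹≈ε⇒x≈y; -‿distribˡ-*; [y-z]x≈yx-zx; +-cancelˡ)
  open ≈-Reasoning setoid

  -- If u i ≉ 0#, the lines through u are spanned by the two equations
  -- u i * v j ≈ u j * v i with j ≢ i.
  module _ (P : Point) (i : Fin 3) (uᵢ≉0 : ¬ proj₁ P i ≈ 0#) where

    private
      u : Vector Carrier 3
      u = proj₁ P

    base : Fin 2 → Vector Carrier 3
    base l = combination (u i) (δ (punchIn i l)) (- u (punchIn i l)) (δ i)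

    base-∙ : ∀ l v → base l ∙ v ≈ u i * v (punchIn i l) - u (punchIn i l) * v i
    base-∙ l v = begin
      base l ∙ v
        ≈⟨ combination-∙ (u i) (δ (punchIn i l)) (- u (punchIn i l)) (δ i) v ⟩
      u i * (δ (punchIn i l) ∙ v) + - u (punchIn i l) * (δ i ∙ v)
        ≈⟨ +-cong (*-congˡ (δᵢ∙v≈vᵢ (punchIn i l) v)) (*-congˡ (δᵢ∙v≈vᵢ i v)) ⟩
      u i * v (punchIn i l) + - u (punchIn i l) * v i
        ≈⟨ +-congˡ (-‿distribˡ-* _ _) ⟨
      u i * v (punchIn i l) - u (punchIn i l) * v i  ∎

    base-∙-u : ∀ l → base l ∙ u ≈ 0#
    base-∙-u l = trans (base-∙ l u) (trans (+-congʳ (*-comm _ _)) (-‿inverseʳ _))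

    base-diagonal : ∀ l → base l (punchIn i l) ≈ u i
    base-diagonal l = begin
      u i * δ (punchIn i l) (punchIn i l) + - u (punchIn i l) * δ i (punchIn i l)
        ≈⟨ +-cong (*-congˡ (δᵢᵢ≈1 (punchIn i l)))
                  (*-congˡ (δᵢⱼ≈0 (Fin.punchInᵢ≢i i l ∘ ≡.sym))) ⟩
      u i * 1# + - u (punchIn i l) * 0#  ≈⟨ +-cong (*-identityʳ _) (zeroʳ _) ⟩
      u i + 0#                           ≈⟨ +-identityʳ _ ⟩
      u i                                ∎

    base-off-diagonal : ∀ l m → l ≢ m → base l (punchIn i m) ≈ 0#
    base-off-diagonal l m l≢m = begin
      u i * δ (punchIn i l) (punchIn i m) + - u (punchIn i l) * δ i (punchIn i m)
        ≈⟨ +-cong (*-congˡ (δᵢⱼ≈0 (l≢m ∘ Fin.punchIn-injective i l m)))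
                  (*-congˡ (δᵢⱼ≈0 (Fin.punchInᵢ≢i i m ∘ ≡.sym))) ⟩
      u i * 0# + - u (punchIn i l) * 0#  ≈⟨ +-cong (zeroʳ _) (zeroʳ _) ⟩
      0# + 0#                            ≈⟨ +-identityʳ _ ⟩
      0#                                 ∎

    affine : Carrier → Vector Carrier 3
    affine t = combination 1# (base 1F) t (base 0F)

    affine-∙ : ∀ t v → affine t ∙ v ≈ base 1F ∙ v + t * (base 0F ∙ v)
    affine-∙ t v = trans (combination-∙ 1# (base 1F) t (base 0F) v) (+-congʳ (*-identityˡ _))

    -- The vanishing minors make `v` proportional to `u` with factor `v i / u i`; this factor is
    -- nonzero because `v` is.
    base-common⇒∼ : (Q : Point) → (∀ l → base l ∙ proj₁ Q ≈ 0#) → P ∼ Q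
    base-common⇒∼ (v , v≋̸0) base≈0 with ≉0⇒inverse uᵢ≉0
    ... | y , yuᵢ≈1 = v i * y , ≉0⇒# α≉0 , αu≈v
      where
      proportional : ∀ k → u i * v k ≈ u k * v i
      proportional k with i Fin.≟ k
      ... | yes ≡.refl = refl
      ... | no i≢k = ≡.subst (λ k → u i * v k ≈ u k * v i) (Fin.punchIn-punchOut i≢k)
        (x∙y⁻¹≈ε⇒x≈y _ _ (trans (sym (base-∙ (punchOut i≢k) v)) (base≈0 (punchOut i≢k))))

      αu≈v : ∀ k → (v i * y) * u k ≈ v k
      αu≈v k = begin
        (v i * y) * u k  ≈⟨ *-congʳ (*-comm _ _) ⟩
        (y * v i) * u k  ≈⟨ *-assoc _ _ _ ⟩
        y * (v i * u k)  ≈⟨ *-congˡ (trans (*-comm _ _) (sym (proportional k))) ⟩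
        y * (u i * v k)  ≈⟨ *-assoc _ _ _ ⟨
        (y * u i) * v k  ≈⟨ *-congʳ yuᵢ≈1 ⟩
        1# * v k         ≈⟨ *-identityˡ _ ⟩
        v k              ∎

      α≉0 : ¬ v i * y ≈ 0#
      α≉0 α≈0 = v≋̸0 λ k → trans (sym (αu≈v k)) (trans (*-congʳ α≈0) (zeroˡ _))

    -- The lines through a point form a projective line: index `zero` is its point at infinity, the
    -- others are the affine parameters `t`. Each form is nonzero because some coordinate other than
    -- `i` equals `u i`.
    pencilAt : Fin (suc q) → Line
    pencilAt zero    = base 0F , λ b≋0 → uᵢ≉0 (trans (sym (base-diagonal 0F)) (b≋0 (punchIn i 0F)))
    pencilAt (suc j) = affine t , λ b≋0 → uᵢ≉0 (begin
      u i  ≈⟨ base-diagonal 1F ⟨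
      base 1F (punchIn i 1F)  ≈⟨ +-identityʳ _ ⟨
      base 1F (punchIn i 1F) + 0#
        ≈⟨ +-cong (sym (*-identityˡ _))
                  (trans (sym (zeroʳ t)) (*-congˡ (sym (base-off-diagonal 0F 1F λ ())))) ⟩
      affine t (punchIn i 1F)  ≈⟨ b≋0 (punchIn i 1F) ⟩
      0#  ∎)
      where t = Inverse.from elements j

    P-on-pencilAt : ∀ j → P on pencilAt j
    P-on-pencilAt zero    = base-∙-u 0F
    P-on-pencilAt (suc j) = begin
      affine t ∙ u                       ≈⟨ affine-∙ t u ⟩
      base 1F ∙ u + t * (base 0F ∙ u)    ≈⟨ +-cong (base-∙-u 1F) (*-congˡ (base-∙-u 0F)) ⟩
      0# + t * 0#                        ≈⟨ trans (+-identityˡ _) (zeroʳ t) ⟩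
      0#                                 ∎
      where t = Inverse.from elements j

    base₀≈0⇒∼ : (Q : Point) → ∀ t → base 0F ∙ proj₁ Q ≈ 0# → affine t ∙ proj₁ Q ≈ 0# → P ∼ Q
    base₀≈0⇒∼ Q@(v , _) t b₀≈0 aff≈0 = base-common⇒∼ Q λ where
      0F → b₀≈0
      1F → begin
        base 1F ∙ v                      ≈⟨ +-identityʳ _ ⟨
        base 1F ∙ v + 0#                 ≈⟨ +-congˡ (trans (*-congˡ b₀≈0) (zeroʳ t)) ⟨
        base 1F ∙ v + t * (base 0F ∙ v)  ≈⟨ affine-∙ t v ⟨
        affine t ∙ v                     ≈⟨ aff≈0 ⟩
        0#                               ∎

    pencilAt-meet : (Q : Point) → ∀ {j k} → j ≢ k → Q on pencilAt j → Q on pencilAt k → P ∼ Q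
    pencilAt-meet Q {zero}  {zero}  j≢k on₁ on₂ = contradiction ≡.refl j≢k
    pencilAt-meet Q {zero}  {suc k} j≢k on₁ on₂ = base₀≈0⇒∼ Q _ on₁ on₂
    pencilAt-meet Q {suc j} {zero}  j≢k on₁ on₂ = base₀≈0⇒∼ Q _ on₂ on₁
    pencilAt-meet Q@(v , _) {suc j} {suc k} j≢k on₁ on₂ =
      -- Subtracting the two equations leaves `(t - t′) * b₀ ≈ 0#` with distinct parameters, so both
      -- basic forms vanish at `Q`.
      base₀≈0⇒∼ Q t (x≉0∧xy≈0⇒y≈0 (t≉t′ ∘ x∙y⁻¹≈ε⇒x≈y t t′) (begin
        (t - t′) * b₀        ≈⟨ [y-z]x≈yx-zx b₀ t t′ ⟩
        t * b₀ - t′ * b₀     ≈⟨ +-congʳ tb₀≈t′b₀ ⟩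
        t′ * b₀ - t′ * b₀    ≈⟨ -‿inverseʳ _ ⟩
        0#                   ∎)) on₁
      where
      t  = Inverse.from elements j
      t′ = Inverse.from elements k
      b₀ = base 0F ∙ v

      t≉t′ : ¬ t ≈ t′
      t≉t′ t≈t′ = j≢k (≡.cong suc (≡.trans (≡.sym (Inverse.strictlyInverseˡ elements j))
        (≡.trans (Inverse.to-cong elements t≈t′) (Inverse.strictlyInverseˡ elements k))))

      tb₀≈t′b₀ : t * b₀ ≈ t′ * b₀
      tb₀≈t′b₀ = +-cancelˡ (base 1F ∙ v) _ _
        (trans (sym (affine-∙ t v)) (trans on₁ (trans (sym on₂) (affine-∙ t′ v))))

  pencil : Point → Fin (suc q) → Line
  pencil P@(_ , u≋̸0) with ≋̸0⇒∃≉0 u≋̸0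
  ... | i , uᵢ≉0 = pencilAt P i uᵢ≉0

  P-on-pencil : ∀ P j → P on pencil P j
  P-on-pencil P@(_ , u≋̸0) with ≋̸0⇒∃≉0 u≋̸0
  ... | i , uᵢ≉0 = P-on-pencilAt P i uᵢ≉0

  pencil-meet : ∀ P Q {j k} → j ≢ k → Q on pencil P j → Q on pencil P k → P ∼ Q
  pencil-meet P@(_ , u≋̸0) with ≋̸0⇒∃≉0 u≋̸0
  ... | i , uᵢ≉0 = pencilAt-meet P i uᵢ≉0

-- Sums of natural numbers

sumℕ-mono-≤ : {f g : Vector ℕ n} → (∀ i → f i ℕ.≤ g i) → sumℕ f ℕ.≤ sumℕ g
sumℕ-mono-≤ {zero}  f≤g = ℕ.z≤n
sumℕ-mono-≤ {suc n} f≤g = ℕ.+-mono-≤ (f≤g zero) (sumℕ-mono-≤ (f≤g ∘ suc))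

≤-sumℕ : (f : Vector ℕ n) (i : Fin n) → f i ℕ.≤ sumℕ f
≤-sumℕ f zero    = ℕ.m≤m+n _ _
≤-sumℕ f (suc i) = ℕ.≤-trans (≤-sumℕ (f ∘ suc) i) (ℕ.m≤n+m _ _)

sumℕ-zero : {f : Vector ℕ n} → (∀ i → f i ≡ 0) → sumℕ f ≡ 0
sumℕ-zero {n} f≡0 = ≡.trans (Sumℕ.sum-cong-≋ f≡0) (Sumℕ.sum-replicate-zero n)

-- Serves the double count: for a fixed point other than the centre, the summands are indexed by the
-- lines of the pencil, and at most one of them contains the point.
sumℕ-atMostOne : {f : Vector ℕ n} {b : ℕ} → (∀ i → f i ℕ.≤ b) →
                 (∀ {i j} → i ≢ j → f i ≡ 0 ⊎ f j ≡ 0) → sumℕ f ℕ.≤ b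
sumℕ-atMostOne {zero}          f≤b disjoint = ℕ.z≤n
sumℕ-atMostOne {suc n} {f} {b} f≤b disjoint with f zero ℕ.≟ 0
... | yes f₀≡0 rewrite f₀≡0 =
  sumℕ-atMostOne (f≤b ∘ suc) (λ i≢j → disjoint (i≢j ∘ Fin.suc-injective))
... | no f₀≢0 = begin
  f zero ℕ.+ sumℕ (f ∘ suc)  ≡⟨ ≡.cong (f zero ℕ.+_) (sumℕ-zero rest≡0) ⟩
  f zero ℕ.+ 0               ≡⟨ ℕ.+-identityʳ _ ⟩
  f zero                     ≤⟨ f≤b zero ⟩
  b                          ∎
  where
  open ℕ.≤-Reasoning
  rest≡0 : ∀ i → f (suc i) ≡ 0
  rest≡0 i with disjoint {zero} {suc i} (λ ())
  ... | inj₁ f₀≡0 = contradiction f₀≡0 f₀≢0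
  ... | inj₂ fᵢ≡0 = fᵢ≡0

length-filter-tabulate : ∀ {A : Set a} {P : Pred A ℓ} (P? : Decidable P) (f : Fin n → A) →
  length (filter P? (tabulate f)) ≡ sumℕ (λ i → if does (P? (f i)) then 1 else 0)
length-filter-tabulate {n = zero}  P? f = ≡.refl
length-filter-tabulate {n = suc n} P? f with does (P? (f zero))
... | true  = ≡.cong suc (length-filter-tabulate P? (f ∘ suc))
... | false = length-filter-tabulate P? (f ∘ suc)

*-≤-sumℕ : ∀ {k} {f : Vector ℕ n} → (∀ i → k ℕ.≤ f i) → n ℕ.* k ℕ.≤ sumℕ f
*-≤-sumℕ {zero}  k≤f = ℕ.z≤n
*-≤-sumℕ {suc n} k≤f = ℕ.+-mono-≤ (k≤f zero) (*-≤-sumℕ (k≤f ∘ suc))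

-- The characteristic of a field with `p` elements

module Torsion (K : FiniteField a ℓ₁ ℓ₂ p) where
  open FiniteField K hiding (zero)
  open Sum semiring using (sum-cong-≋; ∑-distrib-+; sum-permute; sum-replicate)
  open Mult semiring using (×-congʳ; ×-congˡ; ×-assocˡ; ×-homo-+) renaming (_×_ to _·_)
  open CommutativeRing (HeytingCommutativeRing.commutativeRing heytingCommutativeRing)
    using (ring)
  open RingProperties ring using (+-cancelˡ; //-rightDividesˡ; //-rightDividesʳ)
  open ≈-Reasoning setoid

  private
    module E = Inverse elements

  shift : Carrier → Permutation.Permutation′ p
  shift x = Permutation.permutation
    (λ i → E.to (E.from i + x)) (λ i → E.to (E.from i - x))
    (λ i → ≡.trans (E.to-cong (trans (+-congʳ (E.strictlyInverseʳ _)) (//-rightDividesˡ x _)))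
                   (E.strictlyInverseˡ i))
    (λ i → ≡.trans (E.to-cong (trans (+-congʳ (E.strictlyInverseʳ _)) (//-rightDividesʳ x _)))
                   (E.strictlyInverseˡ i))

  -- Translating by x permutes K, so Σ y = Σ (y + x) = Σ y + p · x.
  p·x≈0 : ∀ x → p · x ≈ 0#
  p·x≈0 x = +-cancelˡ (sum E.from) _ _ (begin
    sum E.from + p · x
      ≈⟨ +-congˡ (sum-replicate p) ⟨
    sum E.from + sum {p} (λ _ → x)
      ≈⟨ ∑-distrib-+ {p} E.from (λ _ → x) ⟨
    sum (λ i → E.from i + x)
      ≈⟨ sum-cong-≋ {p} (λ i → sym (E.strictlyInverseʳ _)) ⟩
    sum (λ i → E.from (E.to (E.from i + x)))
      ≈⟨ sum-permute E.from (shift x) ⟨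
    sum E.from
      ≈⟨ +-identityʳ _ ⟨
    sum E.from + 0#  ∎)

  i·0≈0 : ∀ i → i · 0# ≈ 0#
  i·0≈0 zero    = refl
  i·0≈0 (suc i) = trans (+-identityˡ _) (i·0≈0 i)

  multiple≈0 : ∀ r {i x} → i · x ≈ 0# → (r ℕ.* i) · x ≈ 0#
  multiple≈0 r {i} {x} i·x≈0 = trans (sym (×-assocˡ x r i)) (trans (×-congʳ r i·x≈0) (i·0≈0 r))

  1+si≡rj⇒x≈0 : ∀ r s {i j x} → 1 ℕ.+ s ℕ.* i ≡ r ℕ.* j → i · x ≈ 0# → j · x ≈ 0# → x ≈ 0#
  1+si≡rj⇒x≈0 r s {i} {j} {x} eq i·x≈0 j·x≈0 = begin
    x                  ≈⟨ +-identityʳ x ⟨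
    x + 0#             ≈⟨ +-congˡ (multiple≈0 s i·x≈0) ⟨
    x + (s ℕ.* i) · x  ≈⟨ ×-congˡ eq ⟩
    (r ℕ.* j) · x      ≈⟨ multiple≈0 r j·x≈0 ⟩
    0#                 ∎

  -- `K` is known only through its order, so characteristic `p` enters by way of `p·x≈0`. As `i` and
  -- `p` are coprime, a Bézout relation turns annihilation by both into annihilation by 1; its two
  -- clauses are the two signs of the relation.
  i·x≈0⇒x≈0 : Prime p → ∀ {i x} .{{_ : NonZero i}} → i ℕ.< p → i · x ≈ 0# → x ≈ 0#
  i·x≈0⇒x≈0 pr i<p i·x≈0 with Coprime.coprime-Bézout (Coprime.prime⇒coprime pr i<p)
  ... | GCD.Bézout.+- r s eq = 1+si≡rj⇒x≈0 r s eq i·x≈0 (p·x≈0 _)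
  ... | GCD.Bézout.-+ r s eq = 1+si≡rj⇒x≈0 s r eq (p·x≈0 _) i·x≈0

-- Vanishing sums of three values, up to sign

module Signs (K : FiniteField a ℓ₁ ℓ₂ p) (p-prime : Prime p) (p≥7 : 7 ℕ.≤ p) where
  open FiniteField K hiding (zero)
  open Torsion K
  open CommutativeRing (HeytingCommutativeRing.commutativeRing heytingCommutativeRing)
    using (ring; +-commutativeSemigroup)
  open RingProperties ring
    using (-‿involutive; -‿+-comm; +-inverseʳ-unique; +-inverseˡ-unique; x+x≈x⇒x≈0)
  open CommutativeSemigroup +-commutativeSemigroup using (x∙yz≈z∙xy; interchange)
  open ≈-Reasoning setoid

  infix 4 _≈±_

  _≈±_ : Carrier → Carrier → Set _
  x ≈± y = x ≈ y ⊎ x ≈ - y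

  ≈±-sym : ∀ {x y} → x ≈± y → y ≈± x
  ≈±-sym (inj₁ x≈y)  = inj₁ (sym x≈y)
  ≈±-sym (inj₂ x≈-y) = inj₂ (trans (sym (-‿involutive _)) (-‿cong (sym x≈-y)))

  ≈±-trans : ∀ {x y z} → x ≈± y → y ≈± z → x ≈± z
  ≈±-trans (inj₁ x≈y)  (inj₁ y≈z)  = inj₁ (trans x≈y y≈z)
  ≈±-trans (inj₁ x≈y)  (inj₂ y≈-z) = inj₂ (trans x≈y y≈-z)
  ≈±-trans (inj₂ x≈-y) (inj₁ y≈z)  = inj₂ (trans x≈-y (-‿cong y≈z))
  ≈±-trans (inj₂ x≈-y) (inj₂ y≈-z) =
    inj₁ (trans x≈-y (trans (-‿cong y≈-z) (-‿involutive _)))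

  ≈±-double : ∀ {x y} → x ≈± y → x + x ≈± y + y
  ≈±-double (inj₁ x≈y)  = inj₁ (+-cong x≈y x≈y)
  ≈±-double (inj₂ x≈-y) = inj₂ (trans (+-cong x≈-y x≈-y) (-‿+-comm _ _))

  _≈±?_ : ∀ x y → Dec (x ≈± y)
  x ≈±? y = (x ≟ y) ⊎-dec (x ≟ - y)

  x+y≈0⇒y≈±x : ∀ {x y} → x + y ≈ 0# → y ≈± x
  x+y≈0⇒y≈±x x+y≈0 = inj₂ (+-inverseʳ-unique _ _ x+y≈0)

  -x≈0⇒x≈0 : ∀ {x} → - x ≈ 0# → x ≈ 0#
  -x≈0⇒x≈0 {x} -x≈0 = trans (sym (+-identityʳ x)) (trans (+-congˡ (sym -x≈0)) (-‿inverseʳ x))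

  ≈±-≉0 : ∀ {x y} → x ≈± y → ¬ y ≈ 0# → ¬ x ≈ 0#
  ≈±-≉0 (inj₁ x≈y)  y≉0 x≈0 = y≉0 (trans (sym x≈y) x≈0)
  ≈±-≉0 (inj₂ x≈-y) y≉0 x≈0 = y≉0 (-x≈0⇒x≈0 (trans (sym x≈-y) x≈0))

  x+x≈0⇒x≈0 : ∀ {x} → x + x ≈ 0# → x ≈ 0#
  x+x≈0⇒x≈0 2x≈0 = i·x≈0⇒x≈0 p-prime {2} (ℕ.≤-trans (ℕ.m≤m+n 3 4) p≥7)
    (trans (+-congˡ (+-identityʳ _)) 2x≈0)

  x+x≈±x⇒x≈0 : ∀ {x} → x + x ≈± x → x ≈ 0#
  x+x≈±x⇒x≈0 (inj₁ 2x≈x)  = x+x≈x⇒x≈0 _ 2x≈x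
  x+x≈±x⇒x≈0 {x} (inj₂ 2x≈-x) = i·x≈0⇒x≈0 p-prime {3} (ℕ.≤-trans (ℕ.m≤m+n 4 3) p≥7)
    (begin
      x + (x + (x + 0#))  ≈⟨ +-congˡ (+-congˡ (+-identityʳ x)) ⟩
      x + (x + x)         ≈⟨ +-congˡ 2x≈-x ⟩
      x - x               ≈⟨ -‿inverseʳ x ⟩
      0#                  ∎)

  -- The two signs give 3x = 0 and 5x = 0. The factor 5 is the largest one that has to be
  -- invertible, and `p≥7` provides for it.
  4x≈±x⇒x≈0 : ∀ {x} → (x + x) + (x + x) ≈± x → x ≈ 0#
  4x≈±x⇒x≈0 {x} (inj₁ 4x≈x) = i·x≈0⇒x≈0 p-prime {3} (ℕ.≤-trans (ℕ.m≤m+n 4 3) p≥7)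
    (begin
      x + (x + (x + 0#))        ≈⟨ +-congˡ (+-congˡ (+-identityʳ x)) ⟩
      x + (x + x)               ≈⟨ +-identityˡ _ ⟨
      0# + (x + (x + x))        ≈⟨ +-congʳ (-‿inverseˡ x) ⟨
      (- x + x) + (x + (x + x)) ≈⟨ +-assoc _ _ _ ⟩
      - x + (x + (x + (x + x))) ≈⟨ +-congˡ (trans (sym (+-assoc _ _ _)) 4x≈x) ⟩
      - x + x                   ≈⟨ -‿inverseˡ x ⟩
      0#                        ∎)
  4x≈±x⇒x≈0 {x} (inj₂ 4x≈-x) = i·x≈0⇒x≈0 p-prime {5} (ℕ.≤-trans (ℕ.m≤m+n 6 1) p≥7)
    (begin
      x + (x + (x + (x + (x + 0#))))  ≈⟨ +-congˡ (+-congˡ (+-congˡ (+-congˡ (+-identityʳ x)))) ⟩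
      x + (x + (x + (x + x)))         ≈⟨ +-congˡ (+-assoc _ _ _) ⟨
      x + ((x + x) + (x + x))         ≈⟨ +-congˡ 4x≈-x ⟩
      x - x                           ≈⟨ -‿inverseʳ x ⟩
      0#                              ∎)

  -- With opposite signs the first two terms would cancel and leave `z ≈ 0#`; so two terms of the
  -- same class are equal.
  three-sum : ∀ {x y z} → x + (y + z) ≈ 0# → ¬ z ≈ 0# → x ≈± y → x ≈ y × (x + x) + z ≈ 0#
  three-sum {x} {y} {z} x+y+z≈0 z≉0 (inj₁ x≈y) =
    x≈y , trans (+-assoc _ _ _) (trans (+-congˡ (+-congʳ x≈y)) x+y+z≈0)
  three-sum {x} {y} {z} x+y+z≈0 z≉0 (inj₂ x≈-y) = contradiction (begin
    z              ≈⟨ +-identityˡ z ⟨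
    0# + z         ≈⟨ +-congʳ (trans (+-congʳ x≈-y) (-‿inverseˡ y)) ⟨
    (x + y) + z    ≈⟨ +-assoc x y z ⟩
    x + (y + z)    ≈⟨ x+y+z≈0 ⟩
    0#             ∎) z≉0

  three-sum-double : ∀ {x y z} → x + (y + z) ≈ 0# → ¬ z ≈ 0# → x ≈± y → z ≈± x + x
  three-sum-double x+y+z≈0 z≉0 x≈±y = x+y≈0⇒y≈±x (proj₂ (three-sum x+y+z≈0 z≉0 x≈±y))

  TwoClasses : Carrier → Carrier → Carrier → Set _
  TwoClasses a b x = x ≈± a ⊎ x ≈± b

  -- By pigeonhole two of the three terms share a class ±g. They are then equal, so the third is -2
  -- times their common value: lying in ±g it would force g = 0, and lying in the other class it
  -- would make that class ±2g. Rotating the sum brings the two terms of one class to the front.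
  no-three-sum : ∀ {a b} → ¬ a ≈ 0# → ¬ b ≈ 0# → ¬ b ≈± a + a → ¬ a ≈± b + b →
                 ∀ {x y z} → TwoClasses a b x → TwoClasses a b y → TwoClasses a b z →
                 ¬ x + (y + z) ≈ 0#
  no-three-sum {a} {b} a≉0 b≉0 b≉±2a a≉±2b = go
    where
    refute : ∀ {g h} → ¬ g ≈ 0# → ¬ h ≈ 0# → ¬ h ≈± g + g →
             ∀ {x y z} → x ≈± g → y ≈± g → z ≈± g ⊎ z ≈± h → ¬ x + (y + z) ≈ 0#
    refute g≉0 h≉0 h≉±2g x± y± (inj₁ z±) eq = g≉0 (x+x≈±x⇒x≈0
      (≈±-trans (≈±-double (≈±-sym x±)) (≈±-trans (≈±-sym
        (three-sum-double eq (≈±-≉0 z± g≉0) (≈±-trans x± (≈±-sym y±)))) z±)))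
    refute g≉0 h≉0 h≉±2g x± y± (inj₂ z±) eq = h≉±2g (≈±-trans (≈±-sym z±)
      (≈±-trans (three-sum-double eq (≈±-≉0 z± h≉0) (≈±-trans x± (≈±-sym y±))) (≈±-double x±)))

    rotate : ∀ {x y z} → x + (y + z) ≈ 0# → y + (z + x) ≈ 0#
    rotate {x} {y} {z} eq = trans (trans (sym (+-assoc y z x)) (+-comm (y + z) x)) eq

    go : ∀ {x y z} → TwoClasses a b x → TwoClasses a b y → TwoClasses a b z → ¬ x + (y + z) ≈ 0#
    go (inj₁ x±) (inj₁ y±) z∈        eq = refute a≉0 b≉0 b≉±2a x± y± z∈ eq
    go (inj₂ x±) (inj₂ y±) z∈        eq = refute b≉0 a≉0 a≉±2b x± y± (swap z∈) eq
    go (inj₁ x±) (inj₂ y±) (inj₁ z±) eq = refute a≉0 b≉0 b≉±2a z± x± (inj₂ y±) (rotate (rotate eq))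
    go (inj₁ x±) (inj₂ y±) (inj₂ z±) eq = refute b≉0 a≉0 a≉±2b y± z± (inj₂ x±) (rotate eq)
    go (inj₂ x±) (inj₁ y±) (inj₁ z±) eq = refute a≉0 b≉0 b≉±2a y± z± (inj₂ x±) (rotate eq)
    go (inj₂ x±) (inj₁ y±) (inj₂ z±) eq = refute b≉0 a≉0 a≉±2b z± x± (inj₂ y±) (rotate (rotate eq))

  -- A term of class ±α must equal α, which leaves -2α for the other. If both were ±2α, they would
  -- be equal and α would be ±4α.
  three-sum-single : ∀ {α x y} → ¬ α ≈ 0# → ¬ x ≈ 0# → ¬ y ≈ 0# →
                     TwoClasses α (α + α) x → TwoClasses α (α + α) y → α + (x + y) ≈ 0# →
                     x ≈ - (α + α) ⊎ y ≈ - (α + α)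
  three-sum-single α≉0 x≉0 y≉0 (inj₁ x±) y∈ eq =
    inj₂ (+-inverseʳ-unique _ _ (proj₂ (three-sum eq y≉0 (≈±-sym x±))))
  three-sum-single α≉0 x≉0 y≉0 (inj₂ x±) (inj₁ y±) eq =
    inj₁ (+-inverseʳ-unique _ _
      (proj₂ (three-sum (trans (+-congˡ (+-comm _ _)) eq) x≉0 (≈±-sym y±))))
  three-sum-single {α} {x} {y} α≉0 x≉0 y≉0 (inj₂ x±) (inj₂ y±) eq =
    contradiction (4x≈±x⇒x≈0 (≈±-trans (≈±-double (≈±-sym x±)) (≈±-sym
      (three-sum-double (trans (trans (sym (+-assoc x y α)) (+-comm _ α)) eq) α≉0
        (≈±-trans x± (≈±-sym y±)))))) α≉0

  -- A term ±2ε would make the other ±4ε, which is in neither class. So both terms are ±ε; having a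
  -- nonzero sum they are equal, and halving gives -ε.
  three-sum-doubled : ∀ {ε x y} → ¬ ε ≈ 0# → ¬ x ≈ 0# → ¬ y ≈ 0# →
                      TwoClasses ε (ε + ε) x → TwoClasses ε (ε + ε) y → (ε + ε) + (x + y) ≈ 0# →
                      x ≈ - ε × y ≈ - ε
  three-sum-doubled {ε} ε≉0 x≉0 y≉0 x∈ y∈ eq = go x∈ y∈
    where
    refute : ∀ {x y} → ¬ y ≈ 0# → x ≈± ε + ε → TwoClasses ε (ε + ε) y → ¬ (ε + ε) + (x + y) ≈ 0#
    refute y≉0 x± (inj₁ y±) eq = ε≉0 (4x≈±x⇒x≈0
      (≈±-trans (≈±-sym (three-sum-double eq y≉0 (≈±-sym x±))) y±))
    refute y≉0 x± (inj₂ y±) eq = ε≉0 (x+x≈0⇒x≈0 (x+x≈±x⇒x≈0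
      (≈±-trans (≈±-sym (three-sum-double eq y≉0 (≈±-sym x±))) y±)))

    go : TwoClasses ε (ε + ε) _ → TwoClasses ε (ε + ε) _ → _ ≈ - ε × _ ≈ - ε
    go (inj₂ x±) y∈        = contradiction eq (refute y≉0 x± y∈)
    go x∈        (inj₂ y±) = contradiction (trans (+-congˡ (+-comm _ _)) eq) (refute x≉0 y± x∈)
    go (inj₁ x±) (inj₁ y±) with three-sum (trans (x∙yz≈z∙xy _ _ _) eq) (ε≉0 ∘ x+x≈0⇒x≈0)
                                          (≈±-trans x± (≈±-sym y±))
    ... | x≈y , 2x+2ε≈0 = x≈-ε , trans (sym x≈y) x≈-ε
      where x≈-ε = +-inverseˡ-unique _ _ (x+x≈0⇒x≈0 (trans (interchange _ _ _ _) 2x+2ε≈0))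

-- Weighted counting on the lines through a support point

module Weights (K : FiniteField a ℓ₁ ℓ₂ p) where
  open FiniteField K hiding (zero)
  open Sum semiring using (sum-cong-≋; sum-remove)
  open ≈-Reasoning setoid

  ind : Carrier → Carrier → ℕ
  ind v x = if does (x ≟ v) then 1 else 0

  nz : Carrier → ℕ
  nz x = if does (¬? (x ≟ 0#)) then 1 else 0

  ind-≈ : ∀ {v x} → x ≈ v → ind v x ≡ 1
  ind-≈ {v} {x} x≈v = ≡.cong (if_then 1 else 0) (dec-true (x ≟ v) x≈v)

  ind-≉ : ∀ {v x} → ¬ x ≈ v → ind v x ≡ 0
  ind-≉ {v} {x} x≉v = ≡.cong (if_then 1 else 0) (dec-false (x ≟ v) x≉v)

  nz-≈0 : ∀ {x} → x ≈ 0# → nz x ≡ 0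
  nz-≈0 {x} x≈0 = ≡.cong (if_then 1 else 0) (dec-false (¬? (x ≟ 0#)) (λ x≉0 → x≉0 x≈0))

  nz-≉0 : ∀ {x} → ¬ x ≈ 0# → nz x ≡ 1
  nz-≉0 {x} x≉0 = ≡.cong (if_then 1 else 0) (dec-true (¬? (x ≟ 0#)) x≉0)

  ind-cong : ∀ {u v x y} → u ≈ v → x ≈ y → ind u x ≡ ind v y
  ind-cong {v = v} {y = y} u≈v x≈y with y ≟ v
  ... | yes y≈v = ≡.trans (ind-≈ (trans x≈y (trans y≈v (sym u≈v)))) (≡.sym (ind-≈ y≈v))
  ... | no y≉v  =
    ≡.trans (ind-≉ (λ x≈u → y≉v (trans (sym x≈y) (trans x≈u u≈v)))) (≡.sym (ind-≉ y≉v))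

  nz-cong : ∀ {x y} → x ≈ y → nz x ≡ nz y
  nz-cong {y = y} x≈y with y ≟ 0#
  ... | yes y≈0 = ≡.trans (nz-≈0 (trans x≈y y≈0)) (≡.sym (nz-≈0 y≈0))
  ... | no y≉0  = ≡.trans (nz-≉0 (λ x≈0 → y≉0 (trans (sym x≈y) x≈0))) (≡.sym (nz-≉0 y≉0))

  -- In the secant bounds `u` is the negative of the value at the centre, the value that completes a
  -- 2-secant, and a positive `ν` surcharges a value occurring on every 3-secant through the centre.
  weight : ℕ → ℕ → Carrier → ℕ → Carrier → Carrier → ℕ
  weight κ μ u ν v x = κ ℕ.* nz x ℕ.+ (μ ℕ.* ind u x ℕ.+ ν ℕ.* ind v x)

  weight-cong : ∀ κ μ u ν v {x y} → x ≈ y → weight κ μ u ν v x ≡ weight κ μ u ν v y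
  weight-cong κ μ u ν v x≈y = ≡.cong₂ ℕ._+_ (≡.cong (κ ℕ.*_) (nz-cong x≈y))
    (≡.cong₂ ℕ._+_ (≡.cong (μ ℕ.*_) (ind-cong refl x≈y)) (≡.cong (ν ℕ.*_) (ind-cong refl x≈y)))

  weight-0 : ∀ κ μ {u} ν {v} → ¬ u ≈ 0# → ¬ v ≈ 0# → weight κ μ u ν v 0# ≡ 0
  weight-0 κ μ {u} ν {v} u≉0 v≉0
    rewrite nz-≈0 {0#} refl | ind-≉ {u} {0#} (u≉0 ∘ sym) | ind-≉ {v} {0#} (v≉0 ∘ sym)
          | ℕ.*-zeroʳ κ | ℕ.*-zeroʳ μ | ℕ.*-zeroʳ ν = ≡.refl

  κ≤weight : ∀ κ μ u ν v {x} → ¬ x ≈ 0# → κ ℕ.≤ weight κ μ u ν v x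
  κ≤weight κ μ u ν v x≉0 rewrite nz-≉0 x≉0 | ℕ.*-identityʳ κ = ℕ.m≤m+n _ _

  κ+μ≤weight : ∀ κ μ u ν v {x} → ¬ x ≈ 0# → x ≈ u → κ ℕ.+ μ ℕ.≤ weight κ μ u ν v x
  κ+μ≤weight κ μ u ν v x≉0 x≈u
    rewrite nz-≉0 x≉0 | ind-≈ x≈u | ℕ.*-identityʳ κ | ℕ.*-identityʳ μ =
    ℕ.+-monoʳ-≤ κ (ℕ.m≤m+n _ _)

  κ+ν≤weight : ∀ κ μ u ν v {x} → ¬ x ≈ 0# → x ≈ v → κ ℕ.+ ν ℕ.≤ weight κ μ u ν v x
  κ+ν≤weight κ μ u ν v x≉0 x≈v
    rewrite nz-≉0 x≉0 | ind-≈ x≈v | ℕ.*-identityʳ κ | ℕ.*-identityʳ ν =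
    ℕ.+-monoʳ-≤ κ (ℕ.m≤n+m _ _)

  sumℕ-weight : ∀ κ μ u ν v (x : Vector Carrier n) → sumℕ (weight κ μ u ν v ∘ x) ≡
    κ ℕ.* sumℕ (nz ∘ x) ℕ.+ (μ ℕ.* sumℕ (ind u ∘ x) ℕ.+ ν ℕ.* sumℕ (ind v ∘ x))
  sumℕ-weight κ μ u ν v x = ≡.trans
    (Sumℕ.∑-distrib-+ (λ i → κ ℕ.* nz (x i)) (λ i → μ ℕ.* ind u (x i) ℕ.+ ν ℕ.* ind v (x i)))
    (≡.cong₂ ℕ._+_ (≡.sym (Sumℕ.*-distribˡ-sum κ (nz ∘ x)))
      (≡.trans (Sumℕ.∑-distrib-+ (λ i → μ ℕ.* ind u (x i)) (λ i → ν ℕ.* ind v (x i)))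
        (≡.cong₂ ℕ._+_ (≡.sym (Sumℕ.*-distribˡ-sum μ (ind u ∘ x)))
                       (≡.sym (Sumℕ.*-distribˡ-sum ν (ind v ∘ x))))))

  wt≡sumℕ-nz : (x : Vector Carrier n) → wt x ≡ sumℕ (nz ∘ x)
  wt≡sumℕ-nz x = length-filter-tabulate (λ i → ¬? (x i ≟ 0#)) id

  NonzeroEntriesIn : Pred Carrier ℓ → Vector Carrier n → Set _
  NonzeroEntriesIn V D = ∀ i → ¬ D i ≈ 0# → V (D i)

  EntryOf : Vector Carrier n → Pred Carrier _
  EntryOf c x = ∃[ i ] x ≈ c i

  -- All that the counting takes from the plane: `m` sets of coordinates that share `i₀` and are
  -- otherwise disjoint, each orthogonal to `c`. Booleans match the form of the incidence vectors.
  record HasPencil (m : ℕ) (c : Vector Carrier n) (i₀ : Fin n) : Set (a ⊔ ℓ₁) where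
    field
      line       : Fin m → Fin n → Bool
      centre     : ∀ j → line j i₀ ≡ true
      meet       : ∀ {i j k} → i ≢ i₀ → j ≢ k → line j i ≡ true → line k i ≢ true
      orthogonal : ∀ j → c ∙ (λ i → if line j i then 1# else 0#) ≈ 0#

  -- A line without its centre is encoded as a full-length vector with 0 off the line. These zeros
  -- weigh nothing by `w 0# ≡ 0`, so swapping the two sums bounds each column by the weight of a
  -- single point.
  pencil-bound : ∀ {c : Vector Carrier n} {i₀} → HasPencil m c i₀ →
    (w : Carrier → ℕ) → (∀ {x y} → x ≈ y → w x ≡ w y) → w 0# ≡ 0 → ∀ k →
    (∀ {r} (D : Vector Carrier r) → NonzeroEntriesIn (EntryOf c) D → c i₀ + sum D ≈ 0# →
      k ℕ.≤ sumℕ (w ∘ D)) →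
    w (c i₀) ℕ.+ m ℕ.* k ℕ.≤ sumℕ (w ∘ c)
  pencil-bound {n = suc n} {m = m} {c} {i₀} pencil w w-cong w0≡0 k k≤line = ≤R.begin
    w (c i₀) ℕ.+ m ℕ.* k
      ≤R.≤⟨ ℕ.+-monoʳ-≤ _ (*-≤-sumℕ lines) ⟩
    w (c i₀) ℕ.+ sumℕ (λ j → sumℕ (λ i → w (D j i)))
      ≤R.≡⟨ ≡.cong (w (c i₀) ℕ.+_) (Sumℕ.∑-comm (λ j i → w (D j i))) ⟩
    w (c i₀) ℕ.+ sumℕ (λ i → sumℕ (λ j → w (D j i)))
      ≤R.≤⟨ ℕ.+-monoʳ-≤ _ (sumℕ-mono-≤ columns) ⟩
    w (c i₀) ℕ.+ sumℕ (λ i → w (c (punchIn i₀ i)))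
      ≤R.≡⟨ Sumℕ.sum-remove {i = i₀} (w ∘ c) ⟨
    sumℕ (w ∘ c)  ≤R.∎
    where
    module ≤R = ℕ.≤-Reasoning
    open HasPencil pencil

    masked : Fin m → Vector Carrier (suc n)
    masked j i = c i * (if line j i then 1# else 0#)

    D : Fin m → Vector Carrier n
    D j i = masked j (punchIn i₀ i)

    on⇒ : ∀ {i j} → line j i ≡ true → masked j i ≈ c i
    on⇒ on rewrite on = *-identityʳ _

    on-or-zero : ∀ j i → line j i ≡ true ⊎ masked j i ≈ 0#
    on-or-zero j i with line j i
    ... | true  = inj₁ ≡.refl
    ... | false = inj₂ (zeroʳ _)

    entry : ∀ j → NonzeroEntriesIn (EntryOf c) (D j)
    entry j i D≉0 with on-or-zero j (punchIn i₀ i)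
    ... | inj₁ on  = punchIn i₀ i , on⇒ on
    ... | inj₂ D≈0 = contradiction D≈0 D≉0

    lines : ∀ j → k ℕ.≤ sumℕ (w ∘ D j)
    lines j = k≤line (D j) (entry j) (begin
      c i₀ + sum (D j)         ≈⟨ +-congʳ (on⇒ (centre j)) ⟨
      masked j i₀ + sum (D j)  ≈⟨ sum-remove {i = i₀} (masked j) ⟨
      sum (masked j)           ≈⟨ orthogonal j ⟩
      0#                       ∎)

    columns : ∀ i → sumℕ (λ j → w (D j i)) ℕ.≤ w (c (punchIn i₀ i))
    columns i = sumℕ-atMostOne entry≤ disjoint
      where
      entry≤ : ∀ j → w (D j i) ℕ.≤ w (c (punchIn i₀ i))
      entry≤ j with on-or-zero j (punchIn i₀ i)
      ... | inj₁ on  = ℕ.≤-reflexive (w-cong (on⇒ on))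
      ... | inj₂ D≈0 = ℕ.≤-trans (ℕ.≤-reflexive (≡.trans (w-cong D≈0) w0≡0)) ℕ.z≤n

      disjoint : ∀ {j k} → j ≢ k → w (D j i) ≡ 0 ⊎ w (D k i) ≡ 0
      disjoint {j} {k} j≢k with on-or-zero j (punchIn i₀ i) | on-or-zero k (punchIn i₀ i)
      ... | inj₂ D≈0 | _        = inj₁ (≡.trans (w-cong D≈0) w0≡0)
      ... | inj₁ _   | inj₂ D≈0 = inj₂ (≡.trans (w-cong D≈0) w0≡0)
      ... | inj₁ on  | inj₁ on′ = contradiction on′ (meet (Fin.punchInᵢ≢i i₀ i) j≢k on)

  module _ (V : Pred Carrier ℓ) (w : Carrier → ℕ) where

    -- Leading zeros are skipped; the entries cannot run out, since that would leave `β ≈ 0#`. Here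
    -- `β` is the partial sum so far, centre included, and `j` is weight already collected.
    first-nonzero : ∀ {r} (D : Vector Carrier r) β j k → ¬ β ≈ 0# → β + sum D ≈ 0# →
      NonzeroEntriesIn V D →
      (∀ {r} x (E : Vector Carrier r) → V x → ¬ x ≈ 0# → NonzeroEntriesIn V E →
        (β + x) + sum E ≈ 0# → k ℕ.≤ j ℕ.+ (w x ℕ.+ sumℕ (w ∘ E))) →
      k ℕ.≤ j ℕ.+ sumℕ (w ∘ D)
    first-nonzero {zero}  D β j k β≉0 eq D∈V step =
      contradiction (trans (sym (+-identityʳ β)) eq) β≉0
    first-nonzero {suc r} D β j k β≉0 eq D∈V step with D zero ≟ 0#
    ... | no x≉0  =
      step (D zero) (D ∘ suc) (D∈V zero x≉0) x≉0 (D∈V ∘ suc) (trans (+-assoc _ _ _) eq)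
    ... | yes x≈0 = ℕ.≤-trans
      (first-nonzero (D ∘ suc) β j k β≉0
        (trans (+-congˡ (trans (sym (+-identityˡ _)) (+-congʳ (sym x≈0)))) eq) (D∈V ∘ suc) step)
      (ℕ.+-monoʳ-≤ j (ℕ.m≤n+m _ _))

    module _ {κ : ℕ} (κ≤w : ∀ {x} → ¬ x ≈ 0# → κ ℕ.≤ w x) where

      one-point : ∀ {r} (D : Vector Carrier r) β → ¬ β ≈ 0# → β + sum D ≈ 0# →
        NonzeroEntriesIn V D → κ ℕ.≤ sumℕ (w ∘ D)
      one-point D β β≉0 eq D∈V = first-nonzero D β 0 κ β≉0 eq D∈V
        λ x E _ x≉0 _ _ → ℕ.≤-trans (κ≤w x≉0) (ℕ.m≤m+n _ _)

      two-points : ∀ {r} (D : Vector Carrier r) β j k → ¬ β ≈ 0# → β + sum D ≈ 0# →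
        NonzeroEntriesIn V D →
        (∀ x → V x → ¬ x ≈ 0# → β + x ≈ 0# → k ℕ.≤ j ℕ.+ w x) →
        (∀ x → V x → ¬ x ≈ 0# → k ℕ.≤ j ℕ.+ (w x ℕ.+ κ)) →
        k ℕ.≤ j ℕ.+ sumℕ (w ∘ D)
      two-points D β j k β≉0 eq D∈V one two = first-nonzero D β j k β≉0 eq D∈V step
        where
        step : ∀ {r} x (E : Vector Carrier r) → V x → ¬ x ≈ 0# → NonzeroEntriesIn V E →
          (β + x) + sum E ≈ 0# → k ℕ.≤ j ℕ.+ (w x ℕ.+ sumℕ (w ∘ E))
        step x E x∈V x≉0 E∈V eq′ with β + x ≟ 0#
        ... | yes β+x≈0 = ℕ.≤-trans (one x x∈V x≉0 β+x≈0) (ℕ.+-monoʳ-≤ j (ℕ.m≤m+n _ _))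
        ... | no β+x≉0  = ℕ.≤-trans (two x x∈V x≉0)
          (ℕ.+-monoʳ-≤ j (ℕ.+-monoʳ-≤ (w x) (one-point E (β + x) β+x≉0 eq′ E∈V)))

      -- Lines are sorted by how soon the partial sums reach 0: after one nonzero entry, after two,
      -- or not by then. In the last case a third nonzero entry must follow and `3κ` is available.
      -- Further entries only add weight, so the first two cases need not describe the whole line.
      three-points : ∀ {r} (D : Vector Carrier r) β k → ¬ β ≈ 0# → β + sum D ≈ 0# →
        NonzeroEntriesIn V D → k ℕ.≤ κ ℕ.+ (κ ℕ.+ κ) →
        (∀ x → V x → ¬ x ≈ 0# → β + x ≈ 0# → k ℕ.≤ w x) →
        (∀ x y → V x → V y → ¬ x ≈ 0# → ¬ y ≈ 0# → β + (x + y) ≈ 0# → k ℕ.≤ w x ℕ.+ w y) →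
        k ℕ.≤ sumℕ (w ∘ D)
      three-points D β k β≉0 eq D∈V k≤3κ one two = first-nonzero D β 0 k β≉0 eq D∈V step
        where
        step : ∀ {r} x (E : Vector Carrier r) → V x → ¬ x ≈ 0# → NonzeroEntriesIn V E →
          (β + x) + sum E ≈ 0# → k ℕ.≤ w x ℕ.+ sumℕ (w ∘ E)
        step x E x∈V x≉0 E∈V eq′ with β + x ≟ 0#
        ... | yes β+x≈0 = ℕ.≤-trans (one x x∈V x≉0 β+x≈0) (ℕ.m≤m+n _ _)
        ... | no β+x≉0  = two-points E (β + x) (w x) k β+x≉0 eq′ E∈V
          (λ y y∈V y≉0 eq″ → two x y x∈V y∈V x≉0 y≉0 (trans (sym (+-assoc _ _ _)) eq″))
          (λ y y∈V y≉0 → ℕ.≤-trans k≤3κ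
            (ℕ.+-mono-≤ (κ≤w x≉0) (ℕ.+-monoˡ-≤ κ (κ≤w y≉0))))

-- Numerical estimates

module Arithmetic where
  open import Data.Nat.Base using (_+_; _*_; _<_; _≤_)
  open ℕ.≤-Reasoning

  s≥2q+3⇒bound : ∀ q s → 2 * q + 3 ≤ s → 12 * q + 18 ≤ 7 * s
  s≥2q+3⇒bound q s h = begin
    12 * q + 18  ≤⟨ ℕ.m≤m+n _ (2 * q + 3) ⟩
    12 * q + 18 + (2 * q + 3)  ≡⟨ lemma q ⟩
    7 * (2 * q + 3)  ≤⟨ ℕ.*-monoʳ-≤ 7 h ⟩
    7 * s  ∎
    where
    lemma : ∀ q → 12 * q + 18 + (2 * q + 3) ≡ 7 * (2 * q + 3)
    lemma = solve-∀

  three-pairs-arith : ∀ {q s A B C} →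
    4 * q + 6 ≤ 2 * s + A → 4 * q + 6 ≤ 2 * s + B →
    4 * q + 6 ≤ 2 * s + C → A + (B + (C + 0)) ≤ s →
    12 * q + 18 ≤ 7 * s
  three-pairs-arith {q} {s} {A} {B} {C} a b c total = begin
    12 * q + 18  ≡⟨ left q ⟩
    (4 * q + 6) + ((4 * q + 6) + (4 * q + 6))
      ≤⟨ ℕ.+-mono-≤ a (ℕ.+-mono-≤ b c) ⟩
    (2 * s + A) + ((2 * s + B) + (2 * s + C))
      ≡⟨ right s A B C ⟩
    6 * s + (A + (B + (C + 0)))  ≤⟨ ℕ.+-monoʳ-≤ (6 * s) total ⟩
    6 * s + s  ≡⟨ ℕ.+-comm (6 * s) s ⟩
    7 * s  ∎
    where
    left : ∀ q → 12 * q + 18 ≡ (4 * q + 6) + ((4 * q + 6) + (4 * q + 6))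
    left = solve-∀
    right : ∀ s A B C → (2 * s + A) + ((2 * s + B) + (2 * s + C)) ≡
                        6 * s + (A + (B + (C + 0)))
    right = solve-∀

  two-pairs-arith : ∀ {q s A B} →
    6 * q + 8 ≤ 2 * s + 2 * A → 6 * q + 8 ≤ 2 * s + 2 * B →
    A + (B + 0) ≤ s → 12 * q + 18 ≤ 7 * s
  two-pairs-arith {q} {s} {A} {B} a b total = ℕ.*-cancelˡ-≤ 6 (begin
    6 * (12 * q + 18)  ≤⟨ ℕ.m≤m+n _ (12 * q + 4) ⟩
    6 * (12 * q + 18) + (12 * q + 4)  ≡⟨ left q ⟩
    7 * ((6 * q + 8) + (6 * q + 8))  ≤⟨ ℕ.*-monoʳ-≤ 7 (ℕ.+-mono-≤ a b) ⟩
    7 * ((2 * s + 2 * A) + (2 * s + 2 * B))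
      ≡⟨ right s A B ⟩
    7 * (4 * s + 2 * (A + (B + 0)))
      ≤⟨ ℕ.*-monoʳ-≤ 7 (ℕ.+-monoʳ-≤ (4 * s) (ℕ.*-monoʳ-≤ 2 total)) ⟩
    7 * (4 * s + 2 * s)  ≡⟨ final s ⟩
    6 * (7 * s)  ∎)
    where
    left : ∀ q → 6 * (12 * q + 18) + (12 * q + 4) ≡
                 7 * ((6 * q + 8) + (6 * q + 8))
    left = solve-∀
    right : ∀ s A B → 7 * ((2 * s + 2 * A) + (2 * s + 2 * B)) ≡
                      7 * (4 * s + 2 * (A + (B + 0)))
    right = solve-∀
    final : ∀ s → 7 * (4 * s + 2 * s) ≡ 6 * (7 * s)
    final = solve-∀

  -- The two bounds are combined with weights 3 and 1.
  double-pair-arith : ∀ {q s A B} → 7 ≤ q →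
    6 * q + 8 ≤ 2 * s + (2 * A + B) →
    12 * q + 16 ≤ 4 * s + (4 * B + A) →
    A + (B + 0) ≤ s → 12 * q + 18 ≤ 7 * s
  double-pair-arith {q} {s} {A} {B} q≥7 a b total = ℕ.*-cancelˡ-≤ 17 (begin
    17 * (12 * q + 18)  ≡⟨ first q ⟩
    204 * q + 264 + 6 * 7
      -- Comparing 7(30q + 40) with 17(12q + 18), there is a surplus of 6q but the constant falls
      -- short by 26; `q≥7` covers it.
      ≤⟨ ℕ.+-monoʳ-≤ (204 * q + 264) (ℕ.*-monoʳ-≤ 6 q≥7) ⟩
    204 * q + 264 + 6 * q  ≤⟨ ℕ.m≤m+n _ 16 ⟩
    204 * q + 264 + 6 * q + 16  ≡⟨ left q ⟩
    7 * (3 * (6 * q + 8) + (12 * q + 16))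
      ≤⟨ ℕ.*-monoʳ-≤ 7 (ℕ.+-mono-≤ (ℕ.*-monoʳ-≤ 3 a) b) ⟩
    7 * (3 * (2 * s + (2 * A + B)) + (4 * s + (4 * B + A)))
      ≡⟨ right s A B ⟩
    7 * (10 * s + 7 * (A + (B + 0)))
      ≤⟨ ℕ.*-monoʳ-≤ 7 (ℕ.+-monoʳ-≤ (10 * s) (ℕ.*-monoʳ-≤ 7 total)) ⟩
    7 * (10 * s + 7 * s)  ≡⟨ final s ⟩
    17 * (7 * s)  ∎)
    where
    first : ∀ q → 17 * (12 * q + 18) ≡ 204 * q + 264 + 6 * 7
    first = solve-∀
    left : ∀ q → 204 * q + 264 + 6 * q + 16 ≡
                 7 * (3 * (6 * q + 8) + (12 * q + 16))
    left = solve-∀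
    right : ∀ s A B →
      7 * (3 * (2 * s + (2 * A + B)) + (4 * s + (4 * B + A))) ≡
      7 * (10 * s + 7 * (A + (B + 0)))
    right = solve-∀
    final : ∀ s → 7 * (10 * s + 7 * s) ≡ 17 * (7 * s)
    final = solve-∀

  -- With p = 9 + m, so that p - 1 needs no subtraction.
  one-pair-arith : ∀ {m q s} → 9 + m ≤ q →
    2 + 2 * (suc q * (8 + m)) ≤ (9 + m) * s → 12 * q + 18 ≤ 7 * s
  one-pair-arith {m} {q} {s} p≤q h = ℕ.*-cancelˡ-≤ (9 + m) (begin
    (9 + m) * (12 * q + 18)  ≡⟨ left m q ⟩
    (108 * q + 126 + 12 * m * q + 14 * m) + 4 * (9 + m)
      -- The surplus over the target is 4q + 2mq against a deficit of 4p, and p ≤ q settles it.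
      ≤⟨ ℕ.+-monoʳ-≤ (108 * q + 126 + 12 * m * q + 14 * m) (ℕ.*-monoʳ-≤ 4 p≤q) ⟩
    (108 * q + 126 + 12 * m * q + 14 * m) + 4 * q
      ≤⟨ ℕ.m≤m+n _ (2 * m * q) ⟩
    (108 * q + 126 + 12 * m * q + 14 * m) + 4 * q + 2 * m * q
      ≡⟨ right m q ⟩
    7 * (2 + 2 * (suc q * (8 + m)))  ≤⟨ ℕ.*-monoʳ-≤ 7 h ⟩
    7 * ((9 + m) * s)  ≡⟨ final m s ⟩
    (9 + m) * (7 * s)  ∎)
    where
    left : ∀ m q → (9 + m) * (12 * q + 18) ≡
      (108 * q + 126 + 12 * m * q + 14 * m) + 4 * (9 + m)
    left = solve-∀
    right : ∀ m q →
      (108 * q + 126 + 12 * m * q + 14 * m) + 4 * q + 2 * m * q ≡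
      7 * (2 + 2 * (suc q * (8 + m)))
    right = solve-∀
    final : ∀ m s → 7 * ((9 + m) * s) ≡ (9 + m) * (7 * s)
    final = solve-∀

  -- Primality excludes 8, where the final estimate would fail: for p = q = 8 the one-pair bound
  -- gives 896 against 912.
  prime>7⇒≡9+ : Prime p → 7 < p → ∃[ m ] p ≡ 9 + m
  prime>7⇒≡9+ {p} p-prime p>7 with 9 ℕ.≤? p
  ... | yes 9≤p with m , 9+m≡p ← ℕ.m≤n⇒∃[o]m+o≡n 9≤p = m , ≡.sym 9+m≡p
  ... | no 9≰p = contradiction (≡.subst Prime p≡8 p-prime) (from-no (prime? 8))
    where
    p≡8 : p ≡ 8
    p≡8 = ℕ.≤-antisym (ℕ.s≤s⁻¹ (ℕ.≰⇒> 9≰p)) p>7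

  -- The second alternative is the one-pair bound with `r = p - 1`. It stays separate because only
  -- the comparison of p with 7 decides which constant it yields.
  Bounds : ℕ → ℕ → ℕ → Set
  Bounds p q s = 12 * q + 18 ≤ 7 * s ⊎ (∀ r → p ≡ suc r → 2 + 2 * (suc q * r) ≤ suc r * s)

  bounds∧p≡7 : ∀ {p q s} → Bounds p q s → p ≡ 7 → 12 * q + 6 ≤ 7 * s
  bounds∧p≡7 {q = q}     (inj₁ bound) p≡7 = ℕ.≤-trans (ℕ.+-monoʳ-≤ (12 * q) (ℕ.m≤m+n 6 12)) bound
  bounds∧p≡7 {q = q} {s} (inj₂ bound) p≡7 = begin
    12 * q + 6  ≤⟨ ℕ.m≤m+n _ 8 ⟩
    12 * q + 6 + 8  ≡⟨ lemma q ⟩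
    2 + 2 * (suc q * 6)  ≤⟨ bound 6 p≡7 ⟩
    7 * s  ∎
    where
    lemma : ∀ q → 12 * q + 6 + 8 ≡ 2 + 2 * (suc q * 6)
    lemma = solve-∀

  bounds∧p>7 : ∀ {p q s} → Bounds p q s → Prime p → 7 < p → p ≤ q → 12 * q + 18 ≤ 7 * s
  bounds∧p>7 (inj₁ bound) p-prime p>7 p≤q = bound
  bounds∧p>7 {q = q} {s} (inj₂ bound) p-prime p>7 p≤q with m , p≡9+m ← prime>7⇒≡9+ p-prime p>7 =
    one-pair-arith {m} {q} {s} (≡.subst (_≤ q) p≡9+m p≤q) (bound (8 + m) p≡9+m)

-- Bounds at a support point of a given value

module Configuration
  (K : FiniteField a ℓ₁ ℓ₂ p) (p-prime : Prime p) (p≥7 : 7 ℕ.≤ p)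
  (c : Vector (FiniteField.Carrier K) n)
  (pencils : ∀ i → Weights.HasPencil K (suc q) c i)
  where

  open FiniteField K hiding (zero)
  open Torsion K using (i·x≈0⇒x≈0)
  open Signs K p-prime p≥7
  open Weights K
  open Arithmetic
  open Mult semiring using (×-homo-+; ×-congˡ) renaming (_×_ to _·_)
  open CommutativeRing (HeytingCommutativeRing.commutativeRing heytingCommutativeRing)
    using (ring)
  open RingProperties ring
    using (-‿involutive; -‿+-comm; +-inverseʳ-unique)

  s : ℕ
  s = sumℕ (nz ∘ c)

  N M : Carrier → ℕ
  N v = sumℕ (ind v ∘ c)
  M v = N v ℕ.+ N (- v)

  Occurs : Carrier → Set _
  Occurs = EntryOf c

  Occurs± : Carrier → Set _
  Occurs± v = Occurs v × Occurs (- v)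

  Occurs-resp : ∀ {x y} → x ≈ y → Occurs x → Occurs y
  Occurs-resp x≈y (i , x≈cᵢ) = i , trans (sym x≈y) x≈cᵢ

  Occurs±-resp : ∀ {x y} → y ≈± x → Occurs± x → Occurs± y
  Occurs±-resp (inj₁ y≈x) (x∈ , -x∈) = Occurs-resp (sym y≈x) x∈ , Occurs-resp (-‿cong (sym y≈x)) -x∈
  Occurs±-resp (inj₂ y≈-x) (x∈ , -x∈) =
    Occurs-resp (sym y≈-x) -x∈ ,
    Occurs-resp (trans (sym (-‿involutive _)) (-‿cong (sym y≈-x))) x∈

  -≉0 : ∀ {x} → ¬ x ≈ 0# → ¬ - x ≈ 0#
  -≉0 x≉0 = x≉0 ∘ -x≈0⇒x≈0

  ≈-≉0 : ∀ {x y} → x ≈ y → ¬ y ≈ 0# → ¬ x ≈ 0#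
  ≈-≉0 x≈y y≉0 x≈0 = y≉0 (trans (sym x≈y) x≈0)

  weight-bound : ∀ κ μ u ν v k {α} → Occurs α → ¬ u ≈ 0# → ¬ v ≈ 0# →
    (∀ {r} (D : Vector Carrier r) → NonzeroEntriesIn Occurs D → α + sum D ≈ 0# →
      k ℕ.≤ sumℕ (weight κ μ u ν v ∘ D)) →
    weight κ μ u ν v α ℕ.+ suc q ℕ.* k ℕ.≤ κ ℕ.* s ℕ.+ (μ ℕ.* N u ℕ.+ ν ℕ.* N v)
  weight-bound κ μ u ν v k {α} (i , α≈cᵢ) u≉0 v≉0 k≤line = begin
    w α ℕ.+ suc q ℕ.* k      ≡⟨ ≡.cong (ℕ._+ suc q ℕ.* k) (weight-cong κ μ u ν v α≈cᵢ) ⟩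
    w (c i) ℕ.+ suc q ℕ.* k
      ≤⟨ pencil-bound (pencils i) w (weight-cong κ μ u ν v) (weight-0 κ μ ν u≉0 v≉0) k
           (λ D D∈ eq → k≤line D D∈ (trans (+-congʳ α≈cᵢ) eq)) ⟩
    sumℕ (w ∘ c)             ≡⟨ sumℕ-weight κ μ u ν v c ⟩
    κ ℕ.* s ℕ.+ (μ ℕ.* N u ℕ.+ ν ℕ.* N v)  ∎
    where
    open ℕ.≤-Reasoning
    w = weight κ μ u ν v

  -- The conditions on `k` match the sorting of lines: `κ + μ` is the weight of one further point of
  -- value -α, `two` treats two further points that complete the sum, and `3κ` covers three or more.
  -- The centre contributes at least `κ`.
  secant-bound : ∀ κ μ ν v k {α u} → Occurs α → ¬ α ≈ 0# → u ≈ - α → ¬ v ≈ 0# →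
    k ℕ.≤ κ ℕ.+ (κ ℕ.+ κ) → k ℕ.≤ κ ℕ.+ μ →
    (∀ x y → Occurs x → Occurs y → ¬ x ≈ 0# → ¬ y ≈ 0# → α + (x + y) ≈ 0# →
      k ℕ.≤ weight κ μ u ν v x ℕ.+ weight κ μ u ν v y) →
    κ ℕ.+ suc q ℕ.* k ℕ.≤ κ ℕ.* s ℕ.+ (μ ℕ.* N u ℕ.+ ν ℕ.* N v)
  secant-bound κ μ ν v k {α} {u} α∈ α≉0 u≈-α v≉0 k≤3κ k≤κ+μ two =
    ℕ.≤-trans (ℕ.+-monoˡ-≤ (suc q ℕ.* k) (κ≤weight κ μ u ν v α≉0))
      (weight-bound κ μ u ν v k α∈ (≈-≉0 u≈-α (-≉0 α≉0)) v≉0 λ D D∈ eq →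
        three-points Occurs (weight κ μ u ν v) (κ≤weight κ μ u ν v) D α k α≉0 eq D∈ k≤3κ
          (λ x _ x≉0 eq → ℕ.≤-trans k≤κ+μ
            (κ+μ≤weight κ μ u ν v x≉0 (trans (+-inverseʳ-unique _ _ eq) (sym u≈-α))))
          two)

  two-secants : ∀ {α u} → Occurs α → ¬ α ≈ 0# → u ≈ - α → 2 ℕ.* q ℕ.+ 3 ℕ.≤ s ℕ.+ N u
  two-secants {α} {u} α∈ α≉0 u≈-α = ≡.subst₂ ℕ._≤_ (left q) (right s (N u))
    -- With `ν = 0` the second surcharge is switched off, and `u` is repeated to supply a nonzero
    -- value.
    (secant-bound 1 1 0 u 2 α∈ α≉0 u≈-α (≈-≉0 u≈-α (-≉0 α≉0)) (ℕ.m≤m+n 2 1) ℕ.≤-refl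
      λ x y _ _ x≉0 y≉0 _ → ℕ.+-mono-≤ (κ≤weight 1 1 u 0 u x≉0) (κ≤weight 1 1 u 0 u y≉0))
    where
    left : ∀ q → 1 ℕ.+ suc q ℕ.* 2 ≡ 2 ℕ.* q ℕ.+ 3
    left = solve-∀
    right : ∀ s N → 1 ℕ.* s ℕ.+ (1 ℕ.* N ℕ.+ 0 ℕ.* N) ≡ s ℕ.+ N
    right = solve-∀

  -- Without 3-secants a line has either a further point of value -α or at least three further
  -- points, so -α can count three times and `k` rises to 3.
  no-three-secants : ∀ {α u} → Occurs α → ¬ α ≈ 0# → u ≈ - α →
    (∀ x y → Occurs x → Occurs y → ¬ x ≈ 0# → ¬ y ≈ 0# → ¬ α + (x + y) ≈ 0#) →
    3 ℕ.* q ℕ.+ 4 ℕ.≤ s ℕ.+ 2 ℕ.* N u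
  no-three-secants {α} {u} α∈ α≉0 u≈-α no3 = ≡.subst₂ ℕ._≤_ (left q) (right s (N u))
    (secant-bound 1 2 0 u 3 α∈ α≉0 u≈-α (≈-≉0 u≈-α (-≉0 α≉0)) ℕ.≤-refl ℕ.≤-refl
      λ x y x∈ y∈ x≉0 y≉0 eq → contradiction eq (no3 x y x∈ y∈ x≉0 y≉0))
    where
    left : ∀ q → 1 ℕ.+ suc q ℕ.* 3 ≡ 3 ℕ.* q ℕ.+ 4
    left = solve-∀
    right : ∀ s N → 1 ℕ.* s ℕ.+ (2 ℕ.* N ℕ.+ 0 ℕ.* N) ≡ s ℕ.+ 2 ℕ.* N
    right = solve-∀

  AllIn : Pred Carrier ℓ → Set _
  AllIn V = ∀ i → ¬ c i ≈ 0# → V (c i)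

  classes : ∀ {a b} → AllIn (TwoClasses a b) → ∀ {x} → Occurs x → ¬ x ≈ 0# → TwoClasses a b x
  classes all (i , x≈cᵢ) x≉0 with all i (≈-≉0 (sym x≈cᵢ) x≉0)
  ... | inj₁ c± = inj₁ (≈±-trans (inj₁ x≈cᵢ) c±)
  ... | inj₂ c± = inj₂ (≈±-trans (inj₁ x≈cᵢ) c±)

  -- The further points of a 3-secant have values α and -2α. Counting -2α twice gives 1 + 2 = 3, the
  -- weight of a single -α counted three times and of three ordinary points.
  single-secants : ∀ {α u v} → AllIn (TwoClasses α (α + α)) → Occurs α → ¬ α ≈ 0# →
    u ≈ - α → v ≈ - (α + α) → 3 ℕ.* q ℕ.+ 4 ℕ.≤ s ℕ.+ (2 ℕ.* N u ℕ.+ N v)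
  single-secants {α} {u} {v} all α∈ α≉0 u≈-α v≈-2α = ≡.subst₂ ℕ._≤_ (left q) (right s (N u) (N v))
    (secant-bound 1 2 1 v 3 α∈ α≉0 u≈-α (≈-≉0 v≈-2α (-≉0 (α≉0 ∘ x+x≈0⇒x≈0))) ℕ.≤-refl ℕ.≤-refl
      two)
    where
    two : ∀ x y → Occurs x → Occurs y → ¬ x ≈ 0# → ¬ y ≈ 0# → α + (x + y) ≈ 0# →
      3 ℕ.≤ weight 1 2 u 1 v x ℕ.+ weight 1 2 u 1 v y
    two x y x∈ y∈ x≉0 y≉0 eq
      with three-sum-single α≉0 x≉0 y≉0 (classes all x∈ x≉0) (classes all y∈ y≉0) eq
    ... | inj₁ x≈-2α = ℕ.+-mono-≤ {2} {_} {1}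
      (κ+ν≤weight 1 2 u 1 v x≉0 (trans x≈-2α (sym v≈-2α))) (κ≤weight 1 2 u 1 v y≉0)
    ... | inj₂ y≈-2α = ℕ.+-mono-≤ {1} {_} {2}
      (κ≤weight 1 2 u 1 v x≉0) (κ+ν≤weight 1 2 u 1 v y≉0 (trans y≈-2α (sym v≈-2α)))
    left : ∀ q → 1 ℕ.+ suc q ℕ.* 3 ≡ 3 ℕ.* q ℕ.+ 4
    left = solve-∀
    right : ∀ s N N′ → 1 ℕ.* s ℕ.+ (2 ℕ.* N ℕ.+ 1 ℕ.* N′) ≡ s ℕ.+ (2 ℕ.* N ℕ.+ N′)
    right = solve-∀

  -- Seen from 2ε, both further points of a 3-secant have value -ε, so each must count 3/2 to reach
  -- 3. All weights are doubled to stay integral: 2 in general, 3 for -ε, 6 for -2ε, and `k = 6`.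
  doubled-secants : ∀ {ε u v} → AllIn (TwoClasses ε (ε + ε)) → Occurs (ε + ε) → ¬ ε ≈ 0# →
    u ≈ - (ε + ε) → v ≈ - ε → 6 ℕ.* q ℕ.+ 8 ℕ.≤ 2 ℕ.* s ℕ.+ (4 ℕ.* N u ℕ.+ N v)
  doubled-secants {ε} {u} {v} all 2ε∈ ε≉0 u≈-2ε v≈-ε = ≡.subst₂ ℕ._≤_ (left q) (right s (N u) (N v))
    (secant-bound 2 4 1 v 6 2ε∈ (ε≉0 ∘ x+x≈0⇒x≈0) u≈-2ε (≈-≉0 v≈-ε (-≉0 ε≉0)) ℕ.≤-refl ℕ.≤-refl
      two)
    where
    two : ∀ x y → Occurs x → Occurs y → ¬ x ≈ 0# → ¬ y ≈ 0# → (ε + ε) + (x + y) ≈ 0# →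
      6 ℕ.≤ weight 2 4 u 1 v x ℕ.+ weight 2 4 u 1 v y
    two x y x∈ y∈ x≉0 y≉0 eq
      with three-sum-doubled ε≉0 x≉0 y≉0 (classes all x∈ x≉0) (classes all y∈ y≉0) eq
    ... | x≈-ε , y≈-ε = ℕ.+-mono-≤ {3} {_} {3}
      (κ+ν≤weight 2 4 u 1 v x≉0 (trans x≈-ε (sym v≈-ε)))
      (κ+ν≤weight 2 4 u 1 v y≉0 (trans y≈-ε (sym v≈-ε)))
    left : ∀ q → 2 ℕ.+ suc q ℕ.* 6 ≡ 6 ℕ.* q ℕ.+ 8
    left = solve-∀
    right : ∀ s N N′ → 2 ℕ.* s ℕ.+ (4 ℕ.* N ℕ.+ 1 ℕ.* N′) ≡ 2 ℕ.* s ℕ.+ (4 ℕ.* N ℕ.+ N′)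
    right = solve-∀

  -- On a line all of whose other values are 0 or α, the number of α's is -1 modulo p.
  one-sign : ∀ {r} → p ≡ suc r → ∀ {α u} → Occurs α → ¬ α ≈ 0# → u ≈ - α → AllIn (_≈± α) →
    1 ℕ.+ suc q ℕ.* r ℕ.≤ N α ℕ.+ r ℕ.* N u
  one-sign {r} p≡1+r {α} {u} α∈ α≉0 u≈-α all =
    ℕ.≤-trans (ℕ.+-monoˡ-≤ (suc q ℕ.* r) (κ+μ≤weight 0 1 α r u α≉0 refl))
      (ℕ.≤-trans (weight-bound 0 1 α r u r α∈ α≉0 u≉0 line)
        (ℕ.≤-reflexive (≡.cong (ℕ._+ r ℕ.* N u) (ℕ.*-identityˡ (N α)))))
    where
    u≉0 = ≈-≉0 u≈-α (-≉0 α≉0)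
    w = weight 0 1 α r u

    sum≈ : ∀ {n} (D : Vector Carrier n) → (∀ i → D i ≈ 0# ⊎ D i ≈ α) →
           sum D ≈ sumℕ (ind α ∘ D) · α
    sum≈ {zero}  D D∈ = refl
    sum≈ {suc n} D D∈ = trans
      (+-cong (head (D∈ zero)) (sum≈ (D ∘ suc) (D∈ ∘ suc)))
      (sym (×-homo-+ α (ind α (D zero)) (sumℕ (ind α ∘ D ∘ suc))))
      where
      head : ∀ {x} → x ≈ 0# ⊎ x ≈ α → x ≈ ind α x · α
      head {x} (inj₁ x≈0) = trans x≈0 (sym (×-congˡ (ind-≉ λ x≈α → α≉0 (trans (sym x≈α) x≈0))))
      head {x} (inj₂ x≈α) = trans x≈α (trans (sym (+-identityʳ α)) (sym (×-congˡ (ind-≈ x≈α))))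

    line : ∀ {n} (D : Vector Carrier n) → NonzeroEntriesIn Occurs D → α + sum D ≈ 0# →
           r ℕ.≤ sumℕ (w ∘ D)
    -- The weight `r = p - 1` of -α is chosen so that one such point matches the least number of α's
    -- that the congruence allows.
    line D D∈ eq with Fin.any? (λ i → D i ≟ u)
    ... | yes (i , Dᵢ≈u) =
      ℕ.≤-trans (κ+ν≤weight 0 1 α r u (≈-≉0 Dᵢ≈u u≉0) Dᵢ≈u) (≤-sumℕ (w ∘ D) i)
    ... | no ∄u = ℕ.≤-trans (ℕ.≮⇒≥ ¬small) (sumℕ-mono-≤ λ i →
        ℕ.≤-trans (ℕ.≤-reflexive (≡.sym (ℕ.*-identityˡ _))) (ℕ.m≤m+n (1 ℕ.* ind α (D i)) _))
      where
      values : ∀ i → D i ≈ 0# ⊎ D i ≈ α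
      values i with D i ≟ 0#
      ... | yes Dᵢ≈0 = inj₁ Dᵢ≈0
      ... | no Dᵢ≉0 with D∈ i Dᵢ≉0
      ... | j , Dᵢ≈cⱼ with all j (≈-≉0 (sym Dᵢ≈cⱼ) Dᵢ≉0)
      ... | inj₁ cⱼ≈α  = inj₂ (trans Dᵢ≈cⱼ cⱼ≈α)
      ... | inj₂ cⱼ≈-α = contradiction (i , trans Dᵢ≈cⱼ (trans cⱼ≈-α (sym u≈-α))) ∄u

      ¬small : ¬ sumℕ (ind α ∘ D) ℕ.< r
      ¬small small = α≉0 (i·x≈0⇒x≈0 p-prime {suc (sumℕ (ind α ∘ D))}
        (≡.subst (suc (sumℕ (ind α ∘ D)) ℕ.<_) (≡.sym p≡1+r) (ℕ.s≤s small))
        (trans (+-congˡ (sym (sum≈ D values))) eq))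

  -- Adding the bounds for the two signs of a value

  total : List Carrier → ℕ
  total []       = 0
  total (v ∷ vs) = M v ℕ.+ total vs

  -- Classes that differ up to sign share no point, and `v` differs from `- v` because 2 is
  -- invertible; hence no support point is counted twice.
  total≤s : ∀ {vs} → All (λ v → ¬ v ≈ 0#) vs → AllPairs (λ u v → ¬ v ≈± u) vs → total vs ℕ.≤ s
  total≤s {vs} vs≉0 distinct =
    ℕ.≤-trans (ℕ.≤-reflexive (total≡ vs)) (sumℕ-mono-≤ (λ i → inds≤nz vs≉0 distinct (c i)))
    where
    inds : List Carrier → Carrier → ℕ
    inds []       x = 0
    inds (v ∷ vs) x = (ind v x ℕ.+ ind (- v) x) ℕ.+ inds vs x

    total≡ : ∀ vs → total vs ≡ sumℕ (inds vs ∘ c)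
    total≡ []       = ≡.sym (sumℕ-zero {f = inds [] ∘ c} (λ _ → ≡.refl))
    total≡ (v ∷ vs) = ≡.sym (≡.trans
      (Sumℕ.∑-distrib-+ (λ i → ind v (c i) ℕ.+ ind (- v) (c i)) (inds vs ∘ c))
      (≡.cong₂ ℕ._+_ (Sumℕ.∑-distrib-+ (ind v ∘ c) (ind (- v) ∘ c)) (≡.sym (total≡ vs))))

    inds≡0 : ∀ {vs x} → All (λ v → ¬ x ≈± v) vs → inds vs x ≡ 0
    inds≡0 [] = ≡.refl
    inds≡0 (x≉±v ∷ rest)
      rewrite ind-≉ (x≉±v ∘ inj₁) | ind-≉ (x≉±v ∘ inj₂) = inds≡0 rest

    inds≤nz : ∀ {vs} → All (λ v → ¬ v ≈ 0#) vs → AllPairs (λ u v → ¬ v ≈± u) vs →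
              ∀ x → inds vs x ℕ.≤ nz x
    inds≤nz []           []                x = ℕ.z≤n
    inds≤nz {v ∷ vs} (v≉0 ∷ vs≉0) (v-distinct ∷ distinct) x with x ≈±? v
    ... | no x≉±v rewrite ind-≉ (x≉±v ∘ inj₁) | ind-≉ (x≉±v ∘ inj₂) = inds≤nz vs≉0 distinct x
    ... | yes x≈±v = ℕ.≤-reflexive (≡.trans
      (≡.cong₂ ℕ._+_ (one x≈±v) (inds≡0 (All.map (λ u≉±v x≈±u →
        u≉±v (≈±-trans (≈±-sym x≈±u) x≈±v)) v-distinct)))
      (≡.sym (nz-≉0 (≈±-≉0 x≈±v v≉0))))
      where
      one : x ≈± v → ind v x ℕ.+ ind (- v) x ≡ 1
      one (inj₁ x≈v)  = ≡.cong₂ ℕ._+_ (ind-≈ x≈v) (ind-≉ λ x≈-v → v≉0 (x+x≈0⇒x≈0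
        (trans (+-congʳ (trans (sym x≈v) x≈-v)) (-‿inverseˡ v))))
      one (inj₂ x≈-v) = ≡.cong₂ ℕ._+_ (ind-≉ λ x≈v → v≉0 (x+x≈0⇒x≈0
        (trans (+-congʳ (trans (sym x≈v) x≈-v)) (-‿inverseˡ v)))) (ind-≈ x≈-v)

  two-secants± : ∀ {v} → Occurs± v → ¬ v ≈ 0# → 4 ℕ.* q ℕ.+ 6 ℕ.≤ 2 ℕ.* s ℕ.+ M v
  two-secants± {v} (v∈ , -v∈) v≉0 = ≡.subst₂ ℕ._≤_ (left q) (right s (N v) (N (- v)))
    (ℕ.+-mono-≤ (two-secants -v∈ (-≉0 v≉0) (sym (-‿involutive v))) (two-secants v∈ v≉0 refl))
    where
    left : ∀ q → (2 ℕ.* q ℕ.+ 3) ℕ.+ (2 ℕ.* q ℕ.+ 3) ≡ 4 ℕ.* q ℕ.+ 6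
    left = solve-∀
    right : ∀ s A B → (s ℕ.+ A) ℕ.+ (s ℕ.+ B) ≡ 2 ℕ.* s ℕ.+ (A ℕ.+ B)
    right = solve-∀

  no-three-secants± : ∀ {a b v} → ¬ a ≈ 0# → ¬ b ≈ 0# → ¬ b ≈± a + a → ¬ a ≈± b + b →
    AllIn (TwoClasses a b) → Occurs± v → ¬ v ≈ 0# → 6 ℕ.* q ℕ.+ 8 ℕ.≤ 2 ℕ.* s ℕ.+ 2 ℕ.* M v
  no-three-secants± {a} {b} {v} a≉0 b≉0 b≉±2a a≉±2b all (v∈ , -v∈) v≉0 =
    ≡.subst₂ ℕ._≤_ (left q) (right s (N v) (N (- v)))
      (ℕ.+-mono-≤ (no-three-secants -v∈ (-≉0 v≉0) (sym (-‿involutive v)) (no3 -v∈ (-≉0 v≉0)))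
                  (no-three-secants v∈ v≉0 refl (no3 v∈ v≉0)))
    where
    no3 : ∀ {α} → Occurs α → ¬ α ≈ 0# → ∀ x y → Occurs x → Occurs y → ¬ x ≈ 0# → ¬ y ≈ 0# →
          ¬ α + (x + y) ≈ 0#
    no3 α∈ α≉0 x y x∈ y∈ x≉0 y≉0 = no-three-sum a≉0 b≉0 b≉±2a a≉±2b
      (classes all α∈ α≉0) (classes all x∈ x≉0) (classes all y∈ y≉0)
    left : ∀ q → (3 ℕ.* q ℕ.+ 4) ℕ.+ (3 ℕ.* q ℕ.+ 4) ≡ 6 ℕ.* q ℕ.+ 8
    left = solve-∀
    right : ∀ s A B → (s ℕ.+ 2 ℕ.* A) ℕ.+ (s ℕ.+ 2 ℕ.* B) ≡ 2 ℕ.* s ℕ.+ 2 ℕ.* (A ℕ.+ B)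
    right = solve-∀

  -- The classes do not see the sign of `e`, so a bound at a centre of value `e` also applies at one
  -- of value `- e`.
  TwoClasses-neg : ∀ {e} → AllIn (TwoClasses e (e + e)) → AllIn (TwoClasses (- e) (- e + - e))
  TwoClasses-neg all i cᵢ≉0 with all i cᵢ≉0
  ... | inj₁ c±e  = inj₁ (≈±-trans c±e (≈±-sym (inj₂ refl)))
  ... | inj₂ c±2e = inj₂ (≈±-trans c±2e (≈±-double (≈±-sym (inj₂ refl))))

  single-secants± : ∀ {e} → AllIn (TwoClasses e (e + e)) → Occurs± e → ¬ e ≈ 0# →
    6 ℕ.* q ℕ.+ 8 ℕ.≤ 2 ℕ.* s ℕ.+ (2 ℕ.* M e ℕ.+ M (e + e))
  single-secants± {e} all (e∈ , -e∈) e≉0 =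
    ≡.subst₂ ℕ._≤_ (left q) (right s (N e) (N (- e)) (N (e + e)) (N (- (e + e))))
      (ℕ.+-mono-≤
        (single-secants (TwoClasses-neg all) -e∈ (-≉0 e≉0) (sym (-‿involutive e))
          (trans (sym (-‿involutive (e + e))) (-‿cong (sym (-‿+-comm e e)))))
        (single-secants all e∈ e≉0 refl refl))
    where
    left : ∀ q → (3 ℕ.* q ℕ.+ 4) ℕ.+ (3 ℕ.* q ℕ.+ 4) ≡ 6 ℕ.* q ℕ.+ 8
    left = solve-∀
    right : ∀ s A B C D → (s ℕ.+ (2 ℕ.* A ℕ.+ C)) ℕ.+ (s ℕ.+ (2 ℕ.* B ℕ.+ D)) ≡
                          2 ℕ.* s ℕ.+ (2 ℕ.* (A ℕ.+ B) ℕ.+ (C ℕ.+ D))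
    right = solve-∀

  doubled-secants± : ∀ {e} → AllIn (TwoClasses e (e + e)) → Occurs± (e + e) → ¬ e ≈ 0# →
    12 ℕ.* q ℕ.+ 16 ℕ.≤ 4 ℕ.* s ℕ.+ (4 ℕ.* M (e + e) ℕ.+ M e)
  doubled-secants± {e} all (2e∈ , -2e∈) e≉0 =
    ≡.subst₂ ℕ._≤_ (left q) (right s (N e) (N (- e)) (N (e + e)) (N (- (e + e))))
      (ℕ.+-mono-≤
        (doubled-secants (TwoClasses-neg all) (Occurs-resp (sym (-‿+-comm e e)) -2e∈) (-≉0 e≉0)
          (trans (sym (-‿involutive (e + e))) (-‿cong (sym (-‿+-comm e e)))) (sym (-‿involutive e)))
        (doubled-secants all 2e∈ e≉0 refl refl))
    where
    left : ∀ q → (6 ℕ.* q ℕ.+ 8) ℕ.+ (6 ℕ.* q ℕ.+ 8) ≡ 12 ℕ.* q ℕ.+ 16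
    left = solve-∀
    right : ∀ s A B C D →
      (2 ℕ.* s ℕ.+ (4 ℕ.* C ℕ.+ A)) ℕ.+ (2 ℕ.* s ℕ.+ (4 ℕ.* D ℕ.+ B)) ≡
      4 ℕ.* s ℕ.+ (4 ℕ.* (C ℕ.+ D) ℕ.+ (A ℕ.+ B))
    right = solve-∀

  -- In the sum of the two `one-sign` bounds, `N v` and `N (- v)` both get the coefficient
  -- `1 + r = p`.
  one-pair : ∀ {r} → p ≡ suc r → ∀ {v} → Occurs± v → ¬ v ≈ 0# → AllIn (_≈± v) →
    2 ℕ.+ 2 ℕ.* (suc q ℕ.* r) ℕ.≤ suc r ℕ.* s
  one-pair {r} p≡1+r {v} (v∈ , -v∈) v≉0 all = ℕ.≤-trans
    (≡.subst₂ ℕ._≤_ (left (suc q ℕ.* r)) (right r (N v) (N (- v)))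
      (ℕ.+-mono-≤ (one-sign p≡1+r v∈ v≉0 refl all)
        (one-sign p≡1+r -v∈ (-≉0 v≉0) (sym (-‿involutive v))
          (λ i cᵢ≉0 → ≈±-trans (all i cᵢ≉0) (≈±-sym (inj₂ refl))))))
    (ℕ.*-monoʳ-≤ (suc r) (total≤s (v≉0 ∷ []) ([] ∷ [])))
    where
    left : ∀ m → (1 ℕ.+ m) ℕ.+ (1 ℕ.+ m) ≡ 2 ℕ.+ 2 ℕ.* m
    left = solve-∀
    right : ∀ r A B → (A ℕ.+ r ℕ.* B) ℕ.+ (B ℕ.+ r ℕ.* A) ≡ suc r ℕ.* (A ℕ.+ B ℕ.+ 0)
    right = solve-∀

  -- Case distinction on the number of pairs of values

  occurs? : ∀ v → Dec (Occurs v)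
  occurs? v = Fin.any? (λ i → v ≟ c i)

  N≡0 : ∀ {v} → ¬ Occurs v → N v ≡ 0
  N≡0 v∉ = sumℕ-zero (λ i → ind-≉ (λ cᵢ≈v → v∉ (i , sym cᵢ≈v)))

  -- In continuation form, so that each newly found value brings its negative along: a missing
  -- negative ends the analysis at once, since 7(2q + 3) = 14q + 21.
  negation-occurs : ∀ {v} → Occurs v → ¬ v ≈ 0# → (Occurs± v → Bounds p q s) → Bounds p q s
  negation-occurs {v} v∈ v≉0 continue with occurs? (- v)
  ... | yes -v∈ = continue (v∈ , -v∈)
  ... | no -v∉  = inj₁ (s≥2q+3⇒bound q s (≡.subst (2 ℕ.* q ℕ.+ 3 ℕ.≤_)
    (≡.trans (≡.cong (s ℕ.+_) (N≡0 -v∉)) (ℕ.+-identityʳ s)) (two-secants v∈ v≉0 refl)))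

  -- The value `f` may be either sign of 2e; the counts are made with the representative `e + e`.
  double-pair : 7 ℕ.≤ q → ∀ {e f} → ¬ e ≈ 0# → f ≈± e + e → Occurs± e → Occurs± f →
    AllIn (TwoClasses e f) → 12 ℕ.* q ℕ.+ 18 ℕ.≤ 7 ℕ.* s
  double-pair q≥7 {e} {f} e≉0 f≈±2e e∈ f∈ all = double-pair-arith {q} {s} {M e} {M (e + e)} q≥7
    (single-secants± all′ e∈ e≉0)
    (doubled-secants± all′ (Occurs±-resp (≈±-sym f≈±2e) f∈) e≉0)
    (total≤s (e≉0 ∷ (e≉0 ∘ x+x≈0⇒x≈0) ∷ []) (((e≉0 ∘ x+x≈±x⇒x≈0) ∷ []) ∷ [] ∷ []))
    where
    all′ : AllIn (TwoClasses e (e + e))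
    all′ i cᵢ≉0 = map₂ (λ c±f → ≈±-trans c±f f≈±2e) (all i cᵢ≉0)

  -- A 3-secant is possible only if one class is, up to sign, the double of the other; the split is
  -- on which class that is, if any.
  two-pairs : 7 ℕ.≤ q → ∀ {a b} → ¬ a ≈ 0# → ¬ b ≈ 0# → ¬ b ≈± a → Occurs± a → Occurs± b →
    AllIn (TwoClasses a b) → 12 ℕ.* q ℕ.+ 18 ℕ.≤ 7 ℕ.* s
  two-pairs q≥7 {a} {b} a≉0 b≉0 b≉±a a∈ b∈ all with b ≈±? (a + a) | a ≈±? (b + b)
  ... | yes b≈±2a | _         = double-pair q≥7 a≉0 b≈±2a a∈ b∈ all
  ... | no _      | yes a≈±2b = double-pair q≥7 b≉0 a≈±2b b∈ a∈ (λ i → swap ∘ all i)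
  ... | no b≉±2a  | no a≉±2b  = two-pairs-arith {q} {s} {M a} {M b}
    (no-three-secants± a≉0 b≉0 b≉±2a a≉±2b all a∈ a≉0)
    (no-three-secants± a≉0 b≉0 b≉±2a a≉±2b all b∈ b≉0)
    (total≤s (a≉0 ∷ b≉0 ∷ []) ((b≉±a ∷ []) ∷ [] ∷ []))

  three-pairs : ∀ {a b d} → ¬ a ≈ 0# → ¬ b ≈ 0# → ¬ d ≈ 0# → ¬ b ≈± a → ¬ d ≈± a → ¬ d ≈± b →
    Occurs± a → Occurs± b → Occurs± d → 12 ℕ.* q ℕ.+ 18 ℕ.≤ 7 ℕ.* s
  three-pairs {a} {b} {d} a≉0 b≉0 d≉0 b≉±a d≉±a d≉±b a∈ b∈ d∈ =
    three-pairs-arith {q} {s} {M a} {M b} {M d}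
      (two-secants± a∈ a≉0) (two-secants± b∈ b≉0) (two-secants± d∈ d≉0)
      (total≤s (a≉0 ∷ b≉0 ∷ d≉0 ∷ []) ((b≉±a ∷ d≉±a ∷ []) ∷ (d≉±b ∷ []) ∷ [] ∷ []))

  bounds : 7 ℕ.≤ q → ¬ c ≋ 0ᵛ → Bounds p q s
  bounds q≥7 c≋̸0 with FiniteFieldProperties.≋̸0⇒∃≉0 K c≋̸0
  ... | i , a≉0 = negation-occurs (i , refl) a≉0 second
    where
    A = c i

    module _ (a∈ : Occurs± A) where
      third : ∀ j → ¬ c j ≈ 0# → ¬ c j ≈± A → Occurs± (c j) → Bounds p q s
      third j b≉0 b≉±a b∈
        with Fin.any? (λ k → ¬? (c k ≟ 0#) ×-dec ¬? (c k ≈±? A) ×-dec ¬? (c k ≈±? c j))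
      ... | yes (k , d≉0 , d≉±a , d≉±b) = negation-occurs (k , refl) d≉0 λ d∈ →
        inj₁ (three-pairs a≉0 b≉0 d≉0 b≉±a d≉±a d≉±b a∈ b∈ d∈)
      ... | no ∄k = inj₁ (two-pairs q≥7 a≉0 b≉0 b≉±a a∈ b∈ all)
        where
        all : AllIn (TwoClasses A (c j))
        all k cₖ≉0 with c k ≈±? A | c k ≈±? c j
        ... | yes c±a | _       = inj₁ c±a
        ... | no _    | yes c±b = inj₂ c±b
        ... | no c≉±a | no c≉±b = contradiction (k , cₖ≉0 , c≉±a , c≉±b) ∄k

      second : Bounds p q s
      second with Fin.any? (λ j → ¬? (c j ≟ 0#) ×-dec ¬? (c j ≈±? A))
      ... | yes (j , b≉0 , b≉±a) = negation-occurs (j , refl) b≉0 (third j b≉0 b≉±a)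
      ... | no ∄j = inj₂ λ r p≡1+r → one-pair p≡1+r a∈ a≉0 λ k cₖ≉0 →
        decidable-stable (c k ≈±? A) (λ c≉±a → ∄j (k , cₖ≉0 , c≉±a))

-- From the dual code of the plane to the theorem

≤⇒/7≤ᵘ/1 : m ℕ.≤ 7 ℕ.* n → (+ m) / 7 ≤ᵘ (+ n) / 1
≤⇒/7≤ᵘ/1 {m = m} {n = n} m≤7n = *≤* (≡.subst₂ ℤ._≤_ (ℤ.pos-* m 1) (ℤ.pos-* n 7)
  (ℤ.+≤+ (≡.subst₂ ℕ._≤_ (≡.sym (ℕ.*-identityʳ m)) (ℕ.*-comm 7 n) m≤7n)))

module DualLineCode
  (F : FiniteField a ℓ₁ ℓ₂ q) (K : FiniteField a′ ℓ₁′ ℓ₂′ p)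
  (enum : Enumeration (PG2.points F) n)
  where

  open PG2 F
  open Pencil F
  open LineCode F K enum
  open FiniteField K hiding (zero; _#_)
  open Weights K

  private
    module E = Inverse enum

  incidenceVector∈C : ∀ L → C (incidenceVector L)
  incidenceVector∈C L = 1 , (λ _ → 1#) , (λ _ → L) ,
    λ k → sym (trans (+-identityʳ _) (*-identityˡ _))

  does⇒ : ∀ {A : Set ℓ} (A? : Dec A) → does A? ≡ true → A
  does⇒ (yes a) _ = a

  -- Each line of the pencil is a generator of the code, hence orthogonal to `c`. The enumeration
  -- identifies points exactly up to `_∼_`, so a coordinate other than `i₀` is a different point and
  -- lies on at most one of the lines.
  dual⇒HasPencil : ∀ {c} → C⊥ c → ∀ i → HasPencil (suc q) c i
  dual⇒HasPencil {c} c∈C⊥ i₀ = record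
    { line       = λ j i → does (E.from i on? pencil P j)
    ; centre     = λ j → dec-true (P on? pencil P j) (P-on-pencil P j)
    ; meet       = λ {i} {j} {k} i≢i₀ j≢k on₁ on₂ →
        i≢i₀ (≡.sym (from-injective (pencil-meet P (E.from i) j≢k
          (does⇒ (E.from i on? pencil P j) on₁) (does⇒ (E.from i on? pencil P k) on₂))))
    ; orthogonal = λ j → c∈C⊥ _ (incidenceVector∈C (pencil P j))
    }
    where
    P : Point
    P = E.from i₀

    from-injective : ∀ {i j} → E.from i ∼ E.from j → i ≡ j
    from-injective {i} {j} i∼j = ≡.trans (≡.sym (E.strictlyInverseˡ i))
      (≡.trans (E.to-cong i∼j) (E.strictlyInverseˡ j))

open import Data.Nat.Base using (_+_; _*_; _^_; _<_; _≤_)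

mainTheorem20 : ∀ {a ℓ₁ ℓ₂ a′ ℓ₁′ ℓ₂′ : Level} (p h q : ℕ) → Prime p → 1 ≤ h → q ≡ p ^ h →
    (F : FiniteField a ℓ₁ ℓ₂ q) (K : FiniteField a′ ℓ₁′ ℓ₂′ p) →
    (n : ℕ) (enum : Enumeration (PG2.points F) n) →
    (c : Vector (FiniteField.Carrier K) n) →
    FiniteField.IsMinimumWeightCodeword K (LineCode.C⊥ F K enum) c →
    (p ≡ 7 → (+ (12 * q + 6)) / 7 ≤ᵘ (+ FiniteField.wt K c) / 1) ×
    (7 < p → (+ (12 * q + 18)) / 7 ≤ᵘ (+ FiniteField.wt K c) / 1)
mainTheorem20 p h q p-prime 1≤h q≡pʰ F K n enum c (c∈C⊥ , c≋̸0 , _) =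
  (λ p≡7 → ≤⇒/7≤ᵘ/1 (bounds∧p≡7 {q = q} (bounds (ℕ.≤-reflexive (≡.sym p≡7))) p≡7)) ,
  (λ p>7 → ≤⇒/7≤ᵘ/1 (bounds∧p>7 {q = q} (bounds (ℕ.<⇒≤ p>7)) p-prime p>7 p≤q))
  where
  open ℕ.≤-Reasoning
  open Arithmetic

  p≤q : p ≤ q
  p≤q = begin
    p      ≡⟨ ℕ.^-identityʳ p ⟨
    p ^ 1  ≤⟨ ℕ.^-monoʳ-≤ p {{prime⇒nonZero p-prime}} 1≤h ⟩
    p ^ h  ≡⟨ q≡pʰ ⟨
    q      ∎

  bounds : 7 ≤ p → Bounds p q (FiniteField.wt K c)
  bounds p≥7 = ≡.subst (Bounds p q) (≡.sym (Weights.wt≡sumℕ-nz K c))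
    (Configuration.bounds K p-prime p≥7 c
      (DualLineCode.dual⇒HasPencil F K enum c∈C⊥) (ℕ.≤-trans p≥7 p≤q) c≋̸0)
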